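{- $\mathrm{SO}$ interprets $\mathrm{ZFC}$; that is, there is an $\mathrm{SO}$-definable $\{\in\}$-structure $\mathcal{A}$ such that $\mathrm{SO}\vdash\mathrm{ZFC}^{\mathcal{A}}$.
   Context: **The theory SO.** $L_{\mathrm{SO}}=\{\mathrm{Ord},\mathrm{SOrd},<,=,\in,\mathrm{G}\}$ is the first-order language with unary predicates $\mathrm{Ord}$ ("is an ordinal"), $\mathrm{SOrd}$ ("is a set of ordinals"), binary predicates $<,=,\in$ and a binary function symbol $\mathrm{G}$. Upper case letters $X,Y,P_i$ range over all objects, lower case Greek letters over objects satisfying $\mathrm{Ord}$, lower case Roman letters over objects satisfying $\mathrm{SOrd}$ (so $\forall\alpha\,\phi$ means $\forall\alpha(\mathrm{Ord}(\alpha)\to\phi)$, etc.). $\alpha\le\beta$ means $\alpha<\beta\lor\alpha=\beta$; $\exists^{=1}$ means "there is exactly one". $\max$ is the maximum with respect to $<$, and $(\alpha,\beta)<^*(\gamma,\delta)$ means: $\max(\alpha,\beta)<\max(\gamma,\delta)$, or the maxima are equal and $\alpha<\gamma$, or the maxima are equal and $\alpha=\gamma$ and $\beta<\delta$. The axioms of $\mathrm{SO}$ are: (SOR) $\forall X,Y\,((\mathrm{Ord}(X)\leftrightarrow\lnot\mathrm{SOrd}(X))\land(X<Y\to\mathrm{Ord}(X)\land\mathrm{Ord}(Y))\land(X\in Y\to\mathrm{Ord}(X)\land\mathrm{SOrd}(Y))\land\mathrm{Ord}(\mathrm{G}(X,Y)))$. (WO) $\forall\alpha,\beta,\gamma\,(\lnot\alpha<\alpha\land(\alpha<\beta\land\beta<\gamma\to\alpha<\gamma)\land(\alpha<\beta\lor\alpha=\beta\lor\beta<\alpha))\land\forall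 a(\exists\alpha(\alpha\in a)\to\exists\alpha(\alpha\in a\land\forall\beta(\beta<\alpha\to\lnot\beta\in a)))$. (INF) $\exists\alpha(\exists\beta(\beta<\alpha)\land\forall\beta(\beta<\alpha\to\exists\gamma(\beta<\gamma\land\gamma<\alpha)))$. (EXT) $\forall a,b(\forall\alpha(\alpha\in a\leftrightarrow\alpha\in b)\to a=b)$. (INI) $\forall\alpha\exists a\forall\beta(\beta<\alpha\leftrightarrow\beta\in a)$. (BOU) $\forall a\exists\alpha\forall\beta(\beta\in a\to\beta<\alpha)$. (GPF) $\forall\alpha,\beta,\gamma\,(\mathrm{G}(\beta,\gamma)\le\alpha\leftrightarrow\forall\delta,\epsilon((\delta,\epsilon)<^*(\beta,\gamma)\to\mathrm{G}(\delta,\epsilon)<\alpha))$. (SUR) $\forall\alpha\exists\beta,\gamma(\alpha=\mathrm{G}(\beta,\gamma))$. (SEP) for every $L_{\mathrm{SO}}$-formula $\phi(\alpha,P_1,\dots,P_n)$: $\forall P_1,\dots,P_n\forall a\exists b\forall\alpha(\alpha\in b\leftrightarrow\alpha\in a\land\phi(\alpha,P_1,\dots,P_n))$. (REP) for every $L_{\mathrm{SO}}$-formula $\phi(\alpha,\beta,P_1,\dots,P_n)$: $\forall P_1,\dots,P_n(\forall\xi,\zeta_1,\zeta_2(\phi(\xi,\zeta_1,\vec P)\land\phi(\xi,\zeta_2,\vec P)\to\zeta_1=\zeta_2)\to\forall a\exists b\forall\zeta(\zeta\in b\leftrightarrow\exists\xi\in a\,\phi(\xi,\zeta,\vec P)))$.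 (POW) $\forall a\exists b\forall z(\exists\alpha(\alpha\in z)\land\forall\alpha(\alpha\in z\to\alpha\in a)\to\exists^{=1}\xi\forall\beta(\beta\in z\leftrightarrow\mathrm{G}(\beta,\xi)\in b))$. **Interpretability.** Let $L_1,L_2$ be first-order languages and $T_1$ an $L_1$-theory. A $T_1$-definable $L_2$-structure $\mathcal{A}$ consists of $L_1$-formulas $\phi_u$ and $\phi_i$ for each non-logical symbol $i$ of $L_2$ and for $=$, such that: $\phi_u$ has exactly one free variable and $T_1\vdash\exists x\,\phi_u(x)$ (write $x\in U$ for $\phi_u(x)$); for an $n$-ary relation symbol $r$ (including $=$) $\phi_r$ has free variables $v_1,\dots,v_n$; for an $n$-ary function symbol $f$, $\phi_f$ has free variables $v_1,\dots,v_{n+1}$ and $T_1$ proves that for all $v_1,\dots,v_n\in U$ there is $v_{n+1}\in U$ with $\phi_f(v_1,\dots,v_{n+1})$, unique up to $\phi_=$; for a constant symbol $c$, $\phi_c$ has one free variable and $T_1$ proves that it is satisfied by an element of $U$, unique up to $\phi_=$; and $T_1$ proves that $\phi_=$ is on $U$ an equivalence relation respecting all relations and functions defined by the formulas of $\mathcal{A}$. For an $L_2$-formula $\psi$, $\psi^{\mathcal{A}}$ is the $L_1$-formula obtained by replacing each symbol (including $=$) by its defining formula (function terms being unravelled in the usual way by existential quantifiers over $U$) and restricting all quantifiers to $U$; $\Phi^{\mathcal{A}}=\{\phi^{\mathcal{A}}:\phi\in\Phi\}$. An $L_1$-theory $T_1$ interprets an $L_2$-theory $T_2$ iff there is a $T_1$-definable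 $L_2$-structure $\mathcal{A}$ with $T_1\vdash T_2^{\mathcal{A}}$. -}

module Defs where

open import Data.Empty using (⊥)
open import Data.Fin using (Fin; zero; suc; lift; _↑ˡ_; _↑ʳ_)
open import Data.List using (List; []; _∷_; map; foldr)
import Data.List as List
open import Data.List.Membership.Propositional using (_∈_)
open import Data.Nat using (ℕ; zero; suc; _+_)
open import Data.Product using (Σ-syntax; _×_)
open import Data.Vec using (Vec; []; _∷_; lookup; tabulate)
open import Data.Vec.Functional using () renaming (_∷_ to infixr 5 _◂_)
open import Function using (_∘_; id)

-- Symbols by arity; constants are function symbols of arity 0.
record Language : Set₁ where
  field
    Rel : ℕ → Set
    Fun : ℕ → Set

open Language public

-- Well-scoped de Bruijn syntax: the index bounds the free variables.
data Term (L : Language) (n : ℕ) : Set where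
  var : Fin n → Term L n
  fun : ∀ {k} → Fun L k → Vec (Term L n) k → Term L n

infix  9 _≐_
infixr 7 _∧_
infixr 6 _∨_
infixr 5 _⇒_
infix  4 _⇔_
infixr 3 ∀′_ ∃′_
infix  8 ¬′_

data Formula (L : Language) (n : ℕ) : Set where
  rel         : ∀ {k} → Rel L k → Vec (Term L n) k → Formula L n
  _≐_         : Term L n → Term L n → Formula L n
  ⊥′          : Formula L n
  _⇒_ _∧_ _∨_ : Formula L n → Formula L n → Formula L n
  ∀′_ ∃′_     : Formula L (suc n) → Formula L n

Sentence : Language → Set
Sentence L = Formula L 0

Theory : Language → Set₁
Theory L = Sentence L → Set

private variable
  L L₁ L₂ : Language
  k m n   : ℕ

¬′_ : Formula L n → Formula L n
¬′ φ = φ ⇒ ⊥′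

_⇔_ : Formula L n → Formula L n → Formula L n
φ ⇔ ψ = (φ ⇒ ψ) ∧ (ψ ⇒ φ)

mutual
  renameᵗ : (Fin m → Fin n) → Term L m → Term L n
  renameᵗ ρ (var x)    = var (ρ x)
  renameᵗ ρ (fun f ts) = fun f (renameᵗˢ ρ ts)

  renameᵗˢ : (Fin m → Fin n) → Vec (Term L m) k → Vec (Term L n) k
  renameᵗˢ ρ []       = []
  renameᵗˢ ρ (t ∷ ts) = renameᵗ ρ t ∷ renameᵗˢ ρ ts

rename : (Fin m → Fin n) → Formula L m → Formula L n
rename ρ (rel r ts) = rel r (renameᵗˢ ρ ts)
rename ρ (s ≐ t)    = renameᵗ ρ s ≐ renameᵗ ρ t
rename ρ ⊥′         = ⊥′
rename ρ (φ ⇒ ψ)    = rename ρ φ ⇒ rename ρ ψ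
rename ρ (φ ∧ ψ)    = rename ρ φ ∧ rename ρ ψ
rename ρ (φ ∨ ψ)    = rename ρ φ ∨ rename ρ ψ
rename ρ (∀′ φ)     = ∀′ rename (lift 1 ρ) φ
rename ρ (∃′ φ)     = ∃′ rename (lift 1 ρ) φ

mutual
  substᵗ : (Fin m → Term L n) → Term L m → Term L n
  substᵗ σ (var x)    = σ x
  substᵗ σ (fun f ts) = fun f (substᵗˢ σ ts)

  substᵗˢ : (Fin m → Term L n) → Vec (Term L m) k → Vec (Term L n) k
  substᵗˢ σ []       = []
  substᵗˢ σ (t ∷ ts) = substᵗ σ t ∷ substᵗˢ σ ts

liftˢ : (Fin m → Term L n) → Fin (suc m) → Term L (suc n)
liftˢ σ = var zero ◂ (renameᵗ suc ∘ σ)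

subst : (Fin m → Term L n) → Formula L m → Formula L n
subst σ (rel r ts) = rel r (substᵗˢ σ ts)
subst σ (s ≐ t)    = substᵗ σ s ≐ substᵗ σ t
subst σ ⊥′         = ⊥′
subst σ (φ ⇒ ψ)    = subst σ φ ⇒ subst σ ψ
subst σ (φ ∧ ψ)    = subst σ φ ∧ subst σ ψ
subst σ (φ ∨ ψ)    = subst σ φ ∨ subst σ ψ
subst σ (∀′ φ)     = ∀′ subst (liftˢ σ) φ
subst σ (∃′ φ)     = ∃′ subst (liftˢ σ) φ

wk : Formula L n → Formula L (suc n)
wk = rename suc

infix 10 _[_]

_[_] : Formula L (suc n) → Term L n → Formula L n
φ [ t ] = subst (t ◂ var) φ

∀* : ∀ n → Formula L n → Sentence L
∀* zero    φ = φ
∀* (suc n) φ = ∀* n (∀′ φ)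

infix 2 _∣_⊢_ _⊢_

data _∣_⊢_ {L} (T : Theory L) {n} (Γ : List (Formula L n)) :
           Formula L n → Set where
  axiom : ∀ {φ} → T φ → T ∣ Γ ⊢ rename (λ ()) φ
  hyp   : ∀ {φ} → φ ∈ Γ → T ∣ Γ ⊢ φ
  raa   : ∀ {φ} → T ∣ ¬′ φ ∷ Γ ⊢ ⊥′ → T ∣ Γ ⊢ φ
  ⇒-I   : ∀ {φ ψ} → T ∣ φ ∷ Γ ⊢ ψ → T ∣ Γ ⊢ φ ⇒ ψ
  ⇒-E   : ∀ {φ ψ} → T ∣ Γ ⊢ φ ⇒ ψ → T ∣ Γ ⊢ φ → T ∣ Γ ⊢ ψ
  ∧-I   : ∀ {φ ψ} → T ∣ Γ ⊢ φ → T ∣ Γ ⊢ ψ → T ∣ Γ ⊢ φ ∧ ψ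
  ∧-E₁  : ∀ {φ ψ} → T ∣ Γ ⊢ φ ∧ ψ → T ∣ Γ ⊢ φ
  ∧-E₂  : ∀ {φ ψ} → T ∣ Γ ⊢ φ ∧ ψ → T ∣ Γ ⊢ ψ
  ∨-I₁  : ∀ {φ ψ} → T ∣ Γ ⊢ φ → T ∣ Γ ⊢ φ ∨ ψ
  ∨-I₂  : ∀ {φ ψ} → T ∣ Γ ⊢ ψ → T ∣ Γ ⊢ φ ∨ ψ
  ∨-E   : ∀ {φ ψ χ} → T ∣ Γ ⊢ φ ∨ ψ →
          T ∣ φ ∷ Γ ⊢ χ → T ∣ ψ ∷ Γ ⊢ χ → T ∣ Γ ⊢ χ
  ∀-I   : ∀ {φ} → T ∣ map wk Γ ⊢ φ → T ∣ Γ ⊢ ∀′ φ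
  ∀-E   : ∀ {φ} → T ∣ Γ ⊢ ∀′ φ → ∀ t → T ∣ Γ ⊢ φ [ t ]
  ∃-I   : ∀ {φ} t → T ∣ Γ ⊢ φ [ t ] → T ∣ Γ ⊢ ∃′ φ
  ∃-E   : ∀ {φ ψ} → T ∣ Γ ⊢ ∃′ φ → T ∣ φ ∷ map wk Γ ⊢ wk ψ → T ∣ Γ ⊢ ψ
  ≐-I   : ∀ t → T ∣ Γ ⊢ t ≐ t
  ≐-E   : ∀ φ {s t} → T ∣ Γ ⊢ s ≐ t → T ∣ Γ ⊢ φ [ s ] → T ∣ Γ ⊢ φ [ t ]
  -- Domains are nonempty; scoping makes this underivable from the other
  -- rules when there are no closed terms.
  dom   : T ∣ Γ ⊢ ∃′ (var zero ≐ var zero)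

_⊢_ : Theory L → Sentence L → Set
T ⊢ φ = T ∣ [] ⊢ φ

v0 : Term L (1 + n)
v0 = var zero
v1 : Term L (2 + n)
v1 = var (suc zero)
v2 : Term L (3 + n)
v2 = var (suc (suc zero))
v3 : Term L (4 + n)
v3 = var (suc (suc (suc zero)))
v4 : Term L (5 + n)
v4 = var (suc (suc (suc (suc zero))))

-- The n free variables of an axiom scheme, seen under m further binders.
params : ∀ m → Fin n → Term L (m + n)
params m = var ∘ (m ↑ʳ_)

infix 10 _⟨_⟩

_⟨_⟩ : Formula L k → Vec (Fin n) k → Formula L n
φ ⟨ xs ⟩ = rename (lookup xs) φ

-- Variable i stands for v_{i+1}, except that in `funᴬ f` variable 0 is the
-- value v_{k+1} and variables 1, …, k are the arguments v₁, …, v_k.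
record Structure (L₁ L₂ : Language) : Set where
  field
    Uᴬ   : Formula L₁ 1
    ≈ᴬ   : Formula L₁ 2
    relᴬ : Rel L₂ k → Formula L₁ k
    funᴬ : Fun L₂ k → Formula L₁ (suc k)

  infix  9 _≈_
  infixr 3 ∀ᵁ_ ∃ᵁ_

  _≈_ : Fin n → Fin n → Formula L₁ n
  x ≈ y = ≈ᴬ ⟨ x ∷ y ∷ [] ⟩

  ∀ᵁ_ ∃ᵁ_ : Formula L₁ (suc n) → Formula L₁ n
  ∀ᵁ φ = ∀′ (Uᴬ ⟨ zero ∷ [] ⟩ ⇒ φ)
  ∃ᵁ φ = ∃′ (Uᴬ ⟨ zero ∷ [] ⟩ ∧ φ)

  ∀ᵁ* : ∀ n → Formula L₁ n → Sentence L₁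
  ∀ᵁ* zero    φ = φ
  ∀ᵁ* (suc n) φ = ∀ᵁ* n (∀ᵁ φ)

  -- Unravelling of terms.  `unravel ρ t κ` asserts κ of a variable denoting
  -- t, introducing a variable of U for every function application in t;
  -- ρ locates the variables of t, and the continuation κ receives the
  -- renaming into the scope extended by the variables introduced.
  mutual
    unravel : (Fin n → Fin m) → Term L₂ n →
              (∀ {m′} → (Fin m → Fin m′) → Fin m′ → Formula L₁ m′) →
              Formula L₁ m
    unravel ρ (var x)    κ = κ id (ρ x)
    unravel ρ (fun f ts) κ = unravel* ρ ts λ τ xs →
      ∃ᵁ (funᴬ f ⟨ zero ∷ Data.Vec.map suc xs ⟩ ∧ κ (suc ∘ τ) zero)

    unravel* : (Fin n → Fin m) → Vec (Term L₂ n) k →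
               (∀ {m′} → (Fin m → Fin m′) → Vec (Fin m′) k → Formula L₁ m′) →
               Formula L₁ m
    unravel* ρ []       κ = κ id []
    unravel* ρ (t ∷ ts) κ = unravel ρ t λ τ x →
      unravel* (τ ∘ ρ) ts λ τ′ xs → κ (τ′ ∘ τ) (τ′ x ∷ xs)

  infix 11 _ᴬ

  _ᴬ : Formula L₂ n → Formula L₁ n
  rel r ts ᴬ = unravel* id ts λ _ xs → relᴬ r ⟨ xs ⟩
  (s ≐ t)  ᴬ = unravel id s λ τ x → unravel τ t λ τ′ y → τ′ x ≈ y
  ⊥′       ᴬ = ⊥′
  (φ ⇒ ψ)  ᴬ = φ ᴬ ⇒ ψ ᴬ
  (φ ∧ ψ)  ᴬ = φ ᴬ ∧ ψ ᴬ
  (φ ∨ ψ)  ᴬ = φ ᴬ ∨ ψ ᴬ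
  (∀′ φ)   ᴬ = ∀ᵁ φ ᴬ
  (∃′ φ)   ᴬ = ∃ᵁ φ ᴬ

  lefts rights : ∀ k → Vec (Fin (k + k)) k
  lefts  k = tabulate (_↑ˡ k)
  rights k = tabulate (k ↑ʳ_)

  assuming≈ : ∀ k → Formula L₁ (k + k) → Formula L₁ (k + k)
  assuming≈ k φ = foldr _⇒_ φ (List.tabulate {n = k} λ i → (i ↑ˡ k) ≈ (k ↑ʳ i))

record IsDefinable (T : Theory L₁) (A : Structure L₁ L₂) : Set where
  open Structure A
  field
    nonempty : T ⊢ ∃′ Uᴬ

    fun-total  : (f : Fun L₂ k) → T ⊢ ∀ᵁ* k (∃ᵁ funᴬ f)
    fun-unique : (f : Fun L₂ k) → T ⊢ ∀ᵁ* k (∀ᵁ ∀ᵁ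
      (rename (lift 1 suc) (funᴬ f) ∧ rename suc (funᴬ f) ⇒ zero ≈ suc zero))

    ≈-refl  : T ⊢ ∀ᵁ zero ≈ zero
    ≈-sym   : T ⊢ ∀ᵁ ∀ᵁ suc zero ≈ zero ⇒ zero ≈ suc zero
    ≈-trans : T ⊢ ∀ᵁ ∀ᵁ ∀ᵁ
      (suc (suc zero) ≈ suc zero ∧ suc zero ≈ zero ⇒ suc (suc zero) ≈ zero)

    rel-cong : (r : Rel L₂ k) → T ⊢ ∀ᵁ* (k + k)
      (assuming≈ k (relᴬ r ⟨ lefts k ⟩ ⇒ relᴬ r ⟨ rights k ⟩))
    fun-cong : (f : Fun L₂ k) → T ⊢ ∀ᵁ* (k + k) (assuming≈ k (∀ᵁ ∀ᵁ
      (funᴬ f ⟨ suc zero ∷ Data.Vec.map (2 ↑ʳ_) (lefts k) ⟩ ∧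
       funᴬ f ⟨ zero ∷ Data.Vec.map (2 ↑ʳ_) (rights k) ⟩ ⇒
       suc zero ≈ zero)))

infix 1 _Interprets_

_Interprets_ : Theory L₁ → Theory L₂ → Set
_Interprets_ {L₁} {L₂} T₁ T₂ =
  Σ[ A ∈ Structure L₁ L₂ ] (IsDefinable T₁ A ×
    (∀ {ψ} → T₂ ψ → T₁ ⊢ Structure._ᴬ A ψ))

data SORel : ℕ → Set where
  Ordˢ SOrdˢ : SORel 1
  <ˢ ∈ˢ      : SORel 2

data SOFun : ℕ → Set where
  Gˢ : SOFun 2

L-SO : Language
L-SO = record { Rel = SORel ; Fun = SOFun }

module SO-axioms where

  infix  9 _<_ _≤_ _∈′_
  infixr 3 ∀ᵒ_ ∃ᵒ_ ∀ˢ_ ∃ˢ_ ∃¹ᵒ_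

  Ord SOrd : Term L-SO n → Formula L-SO n
  Ord  t = rel Ordˢ  (t ∷ [])
  SOrd t = rel SOrdˢ (t ∷ [])

  _<_ _≤_ _∈′_ : Term L-SO n → Term L-SO n → Formula L-SO n
  s < t  = rel <ˢ (s ∷ t ∷ [])
  s ∈′ t = rel ∈ˢ (s ∷ t ∷ [])
  s ≤ t  = s < t ∨ s ≐ t

  G : Term L-SO n → Term L-SO n → Term L-SO n
  G s t = fun Gˢ (s ∷ t ∷ [])

  ∀ᵒ_ ∃ᵒ_ ∀ˢ_ ∃ˢ_ ∃¹ᵒ_ : Formula L-SO (suc n) → Formula L-SO n
  ∀ᵒ φ  = ∀′ (Ord v0 ⇒ φ)
  ∃ᵒ φ  = ∃′ (Ord v0 ∧ φ)
  ∀ˢ φ  = ∀′ (SOrd v0 ⇒ φ)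
  ∃ˢ φ  = ∃′ (SOrd v0 ∧ φ)
  ∃¹ᵒ φ = ∃ᵒ (φ ∧ (∀ᵒ rename (lift 1 suc) φ ⇒ v0 ≐ v1))

  IsMax : Term L-SO n → Term L-SO n → Term L-SO n → Formula L-SO n
  IsMax μ α β = (μ ≐ α ∨ μ ≐ β) ∧ α ≤ μ ∧ β ≤ μ

  -- (α,β) <* (γ,δ), where max, not being a symbol of the language, is
  -- eliminated by naming μ = max(α,β) and ν = max(γ,δ).
  pair< : (α β γ δ : Term L-SO n) → Formula L-SO n
  pair< α β γ δ = ∃ᵒ ∃ᵒ
    let ↑ = renameᵗ (2 ↑ʳ_) ; μ = v1 ; ν = v0 in
    IsMax μ (↑ α) (↑ β) ∧ IsMax ν (↑ γ) (↑ δ) ∧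
      (μ < ν
      ∨ μ ≐ ν ∧ ↑ α < ↑ γ
      ∨ μ ≐ ν ∧ ↑ α ≐ ↑ γ ∧ ↑ β < ↑ δ)

  SOR WO INF EXT INI BOU GPF SUR POW : Sentence L-SO

  SOR = ∀′ ∀′ let X = v1 ; Y = v0 in
    (Ord X ⇔ ¬′ SOrd X)
    ∧ (X < Y ⇒ Ord X ∧ Ord Y)
    ∧ (X ∈′ Y ⇒ Ord X ∧ SOrd Y)
    ∧ Ord (G X Y)

  WO = ∀ᵒ ∀ᵒ ∀ᵒ let α = v2 ; β = v1 ; γ = v0 in
    (¬′ (α < α)
     ∧ (α < β ∧ β < γ ⇒ α < γ)
     ∧ (α < β ∨ α ≐ β ∨ β < α))
    ∧ (∀ˢ (∃ᵒ let a = v1 ; α = v0 in α ∈′ a)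
        ⇒ (∃ᵒ let a = v1 ; α = v0 in α ∈′ a
            ∧ (∀ᵒ let a = v2 ; α = v1 ; β = v0 in β < α ⇒ ¬′ (β ∈′ a))))

  INF = ∃ᵒ
    (∃ᵒ let α = v1 ; β = v0 in β < α)
    ∧ (∀ᵒ let α = v1 ; β = v0 in β < α
        ⇒ (∃ᵒ let α = v2 ; β = v1 ; γ = v0 in β < γ ∧ γ < α))

  EXT = ∀ˢ ∀ˢ let a = v1 ; b = v0 in
    (∀ᵒ let a = v2 ; b = v1 ; α = v0 in α ∈′ a ⇔ α ∈′ b) ⇒ a ≐ b

  INI = ∀ᵒ ∃ˢ ∀ᵒ let α = v2 ; a = v1 ; β = v0 in β < α ⇔ β ∈′ a

  BOU = ∀ˢ ∃ᵒ ∀ᵒ let a = v2 ; α = v1 ; β = v0 in β ∈′ a ⇒ β < α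

  GPF = ∀ᵒ ∀ᵒ ∀ᵒ let α = v2 ; β = v1 ; γ = v0 in
    G β γ ≤ α
    ⇔ (∀ᵒ ∀ᵒ let α = v4 ; β = v3 ; γ = v2 ; δ = v1 ; ε = v0 in
        pair< δ ε β γ ⇒ G δ ε < α)

  SUR = ∀ᵒ ∃ᵒ ∃ᵒ let α = v2 ; β = v1 ; γ = v0 in α ≐ G β γ

  SEP : Formula L-SO (1 + n) → Sentence L-SO
  SEP {n} φ = ∀* n (∀ˢ ∃ˢ ∀ᵒ let a = v2 ; b = v1 ; α = v0 in
    α ∈′ b ⇔ α ∈′ a ∧ subst (α ◂ params 3) φ)

  -- The first two variables of φ are ξ and ζ.
  REP : Formula L-SO (2 + n) → Sentence L-SO
  REP {n} φ = ∀* n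
    ((∀ᵒ ∀ᵒ ∀ᵒ let ξ = v2 ; ζ₁ = v1 ; ζ₂ = v0 in
       subst (ξ ◂ ζ₁ ◂ params 3) φ ∧ subst (ξ ◂ ζ₂ ◂ params 3) φ ⇒ ζ₁ ≐ ζ₂)
     ⇒ (∀ˢ ∃ˢ ∀ᵒ let b = v1 ; ζ = v0 in
         ζ ∈′ b ⇔ (∃ᵒ let a = v3 ; ζ = v1 ; ξ = v0 in
                     ξ ∈′ a ∧ subst (ξ ◂ ζ ◂ params 4) φ)))

  POW = ∀ˢ ∃ˢ ∀ˢ
    (∃ᵒ let z = v1 ; α = v0 in α ∈′ z)
    ∧ (∀ᵒ let a = v3 ; z = v1 ; α = v0 in α ∈′ z ⇒ α ∈′ a)
    ⇒ (∃¹ᵒ ∀ᵒ let b = v3 ; z = v2 ; ξ = v1 ; β = v0 in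
         β ∈′ z ⇔ G β ξ ∈′ b)

data SO : Theory L-SO where
  sor : SO SO-axioms.SOR
  wo  : SO SO-axioms.WO
  inf : SO SO-axioms.INF
  ext : SO SO-axioms.EXT
  ini : SO SO-axioms.INI
  bou : SO SO-axioms.BOU
  gpf : SO SO-axioms.GPF
  sur : SO SO-axioms.SUR
  sep : (φ : Formula L-SO (1 + n)) → SO (SO-axioms.SEP φ)
  rep : (φ : Formula L-SO (2 + n)) → SO (SO-axioms.REP φ)
  pow : SO SO-axioms.POW

data ∈Rel : ℕ → Set where
  ∈ˢ : ∈Rel 2

L-∈ : Language
L-∈ = record { Rel = ∈Rel ; Fun = λ _ → ⊥ }

module ZFC-axioms where

  infix  9 _∈′_
  infixr 3 ∃¹_

  _∈′_ : Term L-∈ n → Term L-∈ n → Formula L-∈ n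
  s ∈′ t = rel ∈ˢ (s ∷ t ∷ [])

  ∃¹_ : Formula L-∈ (suc n) → Formula L-∈ n
  ∃¹ φ = ∃′ (φ ∧ (∀′ rename (lift 1 suc) φ ⇒ v0 ≐ v1))

  Extensionality Foundation Pairing Union Power Infinity Choice : Sentence L-∈

  Extensionality = ∀′ ∀′ let x = v1 ; y = v0 in
    (∀′ let x = v2 ; y = v1 ; z = v0 in z ∈′ x ⇔ z ∈′ y) ⇒ x ≐ y

  Foundation = ∀′
    (∃′ let x = v1 ; y = v0 in y ∈′ x)
    ⇒ (∃′ let x = v1 ; y = v0 in y ∈′ x
        ∧ ¬′ (∃′ let x = v2 ; y = v1 ; z = v0 in z ∈′ x ∧ z ∈′ y))

  Pairing = ∀′ ∀′ ∃′ ∀′ let x = v3 ; y = v2 ; p = v1 ; z = v0 in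
    z ∈′ p ⇔ z ≐ x ∨ z ≐ y

  Union = ∀′ ∃′ ∀′ let u = v1 ; z = v0 in
    z ∈′ u ⇔ (∃′ let x = v3 ; z = v1 ; y = v0 in y ∈′ x ∧ z ∈′ y)

  Power = ∀′ ∃′ ∀′ let p = v1 ; z = v0 in
    z ∈′ p ⇔ (∀′ let x = v3 ; z = v1 ; w = v0 in w ∈′ z ⇒ w ∈′ x)

  -- Some x contains ∅, and contains s = y ∪ {y} for each y ∈ x.
  Infinity = ∃′
    (∃′ let x = v1 ; e = v0 in e ∈′ x
      ∧ (∀′ let e = v1 ; z = v0 in ¬′ (z ∈′ e)))
    ∧ (∀′ let x = v1 ; y = v0 in y ∈′ x
        ⇒ (∃′ let x = v2 ; s = v0 in s ∈′ x
            ∧ (∀′ let y = v2 ; s = v1 ; z = v0 in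
                z ∈′ s ⇔ z ∈′ y ∨ z ≐ y)))

  Separation : Formula L-∈ (1 + n) → Sentence L-∈
  Separation {n} φ = ∀* n (∀′ ∃′ ∀′ let x = v2 ; y = v1 ; z = v0 in
    z ∈′ y ⇔ z ∈′ x ∧ subst (z ◂ params 3) φ)

  -- The first two variables of φ are x and y.
  Replacement : Formula L-∈ (2 + n) → Sentence L-∈
  Replacement {n} φ = ∀* n
    ((∀′ ∀′ ∀′ let x = v2 ; y₁ = v1 ; y₂ = v0 in
       subst (x ◂ y₁ ◂ params 3) φ ∧ subst (x ◂ y₂ ◂ params 3) φ ⇒ y₁ ≐ y₂)
     ⇒ (∀′ ∃′ ∀′ let b = v1 ; y = v0 in
         y ∈′ b ⇔ (∃′ let a = v3 ; y = v1 ; x = v0 in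
                     x ∈′ a ∧ subst (x ◂ y ◂ params 4) φ)))

  -- Every family of nonempty, pairwise disjoint sets has a set meeting each
  -- of its members in exactly one element.
  Choice = ∀′
    (∀′ let x = v1 ; y = v0 in y ∈′ x
      ⇒ (∃′ let y = v1 ; z = v0 in z ∈′ y))
    ∧ (∀′ ∀′ let x = v2 ; y = v1 ; y′ = v0 in
        y ∈′ x ∧ y′ ∈′ x
        ∧ (∃′ let y = v2 ; y′ = v1 ; z = v0 in z ∈′ y ∧ z ∈′ y′)
        ⇒ y ≐ y′)
    ⇒ (∃′ ∀′ let x = v2 ; y = v0 in y ∈′ x
        ⇒ (∃¹ let c = v2 ; y = v1 ; z = v0 in z ∈′ y ∧ z ∈′ c))

data ZFC : Theory L-∈ where
  extensionality : ZFC ZFC-axioms.Extensionality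
  foundation     : ZFC ZFC-axioms.Foundation
  pairing        : ZFC ZFC-axioms.Pairing
  union          : ZFC ZFC-axioms.Union
  power          : ZFC ZFC-axioms.Power
  infinity       : ZFC ZFC-axioms.Infinity
  separation     : (φ : Formula L-∈ (1 + n)) → ZFC (ZFC-axioms.Separation φ)
  replacement    : (φ : Formula L-∈ (2 + n)) → ZFC (ZFC-axioms.Replacement φ)
  choice         : ZFC ZFC-axioms.Choice

{-# OPTIONS --safe #-}
module Submission where

-- The proof is semantic: a sentence is a theorem of SO if it holds in all models of SO.  The falsum
-- of a model is an arbitrary type R, and ∨ and ∃ are double-negated with respect to R; for such
-- models Henkin's construction is constructive, with the derivations of the given sentence as R.
--
-- In a model of SO every object x is read as the name of a set.  Its nodes are the ordinals; there
-- is an edge from β to γ if β < γ and G(β,γ) ∈ x, and β is a root if G(β,β) ∈ x.  A node denotes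
-- the set of what its predecessors denote, and x the set of what its roots denote.  Equality is
-- bisimilarity, witnessed by sets of codes G(β,γ).  Since edges increase, every object is a
-- well-founded name, and nodes are handled by induction on ordinals.  Union, separation and choice
-- only change the roots of a name; for choice one takes least ordinals.  For pairing, power set and
-- replacement, a class whose members have names bounded by a single ordinal is a set, because POW
-- indexes the subsets of an ordinal by ordinals; for replacement REP provides the bound.

open import Defs

open import Data.Fin using (Fin; zero; suc; lift)
open import Data.List using (List; []; _∷_; map; _++_)
open import Data.List.Membership.Propositional using (_∈_)
open import Data.List.Membership.Propositional.Properties using (∈-map⁺; ∈-map⁻; ∈-++⁺ˡ; ∈-++⁺ʳ)
open import Data.List.Relation.Unary.All as All using (All; []; _∷_)
open import Data.List.Relation.Unary.All.Properties using (++⁺; map⁺)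
open import Data.List.Relation.Unary.Any using (here; there)
open import Data.Nat using (ℕ; zero; suc; _≤_; _+_; _⊔_; _≟_; z≤n; s≤s; _≤′_; ≤′-refl; ≤′-step)
open import Data.Nat.Properties using
  (≤-refl; ≤-trans; m≤m⊔n; m≤n⊔m; ≤⇒≤′; ≤′⇒≤; n≤1+n; <⇒≢; m≤n+m; +-suc; +-identityʳ; ⊔-lub)
open import Data.Product using (_×_; _,_; proj₁; proj₂; Σ-syntax)
open import Data.Sum using (_⊎_; inj₁; inj₂)
open import Data.Vec using (Vec; []; _∷_; replicate)
open import Data.Vec.Functional using () renaming (_∷_ to infixr 5 _◂_)
open import Data.Unit using (⊤)
open import Function using (_∘_; id)
open import Relation.Binary.PropositionalEquality as ≡ using (_≡_; refl; sym; trans; cong; cong₂)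
open import Relation.Nullary using (yes; no; contradiction)

-- The arbitrary falsum is what lets completeness be proved without deciding anything. Whether `T`
-- with `¬′ φ` is consistent is undecidable, but an inconsistency always yields a derivation of `φ`;
-- with such derivations as falsum this is all the consistency that the term model needs.
--
-- An object of `SO` is at most a set of ordinals, so a whole set, with everything below it, must be
-- packed into one set of codes. Edges use only codes G(β,γ) with β < γ, which leaves the diagonal
-- codes free to mark the roots: the roots of a name can be exchanged while its edges, and so the
-- denotations of its nodes, stay the same.
--
-- The price is that a set has many names and none is canonical. Hence no construction picks
-- representatives: a class is collected by taking all names below a bound at once, and a set that
-- occurs repeatedly does no harm because equality is bisimilarity. For the same reason minima are
-- taken over all nodes bisimilar to the given ones, not over the given nodes alone.

private variable
  L : Language
  k l m n : ℕ

-- Renaming and substitution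

mutual
  -- Reducing renaming to substitution allows the laws below to be derived from those for
  -- substitutions. Hypotheses about maps of variables are pointwise throughout, in place of
  -- function extensionality.
  renameᵗ≡substᵗ : {ρ : Fin m → Fin n} {σ : Fin m → Term L n} → (∀ i → var (ρ i) ≡ σ i) →
                   ∀ t → renameᵗ ρ t ≡ substᵗ σ t
  renameᵗ≡substᵗ e (var x)    = e x
  renameᵗ≡substᵗ e (fun f ts) = cong (fun f) (renameᵗˢ≡substᵗˢ e ts)

  renameᵗˢ≡substᵗˢ : {ρ : Fin m → Fin n} {σ : Fin m → Term L n} → (∀ i → var (ρ i) ≡ σ i) →
                     ∀ (ts : Vec (Term L m) k) → renameᵗˢ ρ ts ≡ substᵗˢ σ ts
  renameᵗˢ≡substᵗˢ e []       = refl
  renameᵗˢ≡substᵗˢ e (t ∷ ts) = cong₂ _∷_ (renameᵗ≡substᵗ e t) (renameᵗˢ≡substᵗˢ e ts)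

rename≡subst : {ρ : Fin m → Fin n} {σ : Fin m → Term L n} → (∀ i → var (ρ i) ≡ σ i) →
               ∀ φ → rename ρ φ ≡ subst σ φ
rename≡subst e (rel r ts) = cong (rel r) (renameᵗˢ≡substᵗˢ e ts)
rename≡subst e (s ≐ t)    = cong₂ _≐_ (renameᵗ≡substᵗ e s) (renameᵗ≡substᵗ e t)
rename≡subst e ⊥′         = refl
rename≡subst e (φ ⇒ ψ)    = cong₂ _⇒_ (rename≡subst e φ) (rename≡subst e ψ)
rename≡subst e (φ ∧ ψ)    = cong₂ _∧_ (rename≡subst e φ) (rename≡subst e ψ)
rename≡subst e (φ ∨ ψ)    = cong₂ _∨_ (rename≡subst e φ) (rename≡subst e ψ)
rename≡subst {ρ = ρ} {σ} e (∀′ φ) = cong ∀′_ (rename≡subst e′ φ)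
  where
  e′ : ∀ i → var (lift 1 ρ i) ≡ liftˢ σ i
  e′ zero    = refl
  e′ (suc i) = cong (renameᵗ suc) (e i)
rename≡subst {ρ = ρ} {σ} e (∃′ φ) = cong ∃′_ (rename≡subst e′ φ)
  where
  e′ : ∀ i → var (lift 1 ρ i) ≡ liftˢ σ i
  e′ zero    = refl
  e′ (suc i) = cong (renameᵗ suc) (e i)

mutual
  substᵗ-id : {σ : Fin n → Term L n} → (∀ i → σ i ≡ var i) → ∀ t → substᵗ σ t ≡ t
  substᵗ-id e (var x)    = e x
  substᵗ-id e (fun f ts) = cong (fun f) (substᵗˢ-id e ts)

  substᵗˢ-id : {σ : Fin n → Term L n} → (∀ i → σ i ≡ var i) →
               ∀ (ts : Vec (Term L n) k) → substᵗˢ σ ts ≡ ts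
  substᵗˢ-id e []       = refl
  substᵗˢ-id e (t ∷ ts) = cong₂ _∷_ (substᵗ-id e t) (substᵗˢ-id e ts)

liftˢ-id : {σ : Fin n → Term L n} → (∀ i → σ i ≡ var i) → ∀ i → liftˢ σ i ≡ var i
liftˢ-id e zero    = refl
liftˢ-id e (suc i) = cong (renameᵗ suc) (e i)

subst-id : {σ : Fin n → Term L n} → (∀ i → σ i ≡ var i) → ∀ φ → subst σ φ ≡ φ
subst-id e (rel r ts) = cong (rel r) (substᵗˢ-id e ts)
subst-id e (s ≐ t)    = cong₂ _≐_ (substᵗ-id e s) (substᵗ-id e t)
subst-id e ⊥′         = refl
subst-id e (φ ⇒ ψ)    = cong₂ _⇒_ (subst-id e φ) (subst-id e ψ)
subst-id e (φ ∧ ψ)    = cong₂ _∧_ (subst-id e φ) (subst-id e ψ)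
subst-id e (φ ∨ ψ)    = cong₂ _∨_ (subst-id e φ) (subst-id e ψ)
subst-id e (∀′ φ)     = cong ∀′_ (subst-id (liftˢ-id e) φ)
subst-id e (∃′ φ)     = cong ∃′_ (subst-id (liftˢ-id e) φ)

mutual
  substᵗ-∘ : {σ : Fin l → Term L m} {τ : Fin m → Term L n} {υ : Fin l → Term L n} →
             (∀ i → substᵗ τ (σ i) ≡ υ i) → ∀ t → substᵗ τ (substᵗ σ t) ≡ substᵗ υ t
  substᵗ-∘ e (var x)    = e x
  substᵗ-∘ e (fun f ts) = cong (fun f) (substᵗˢ-∘ e ts)

  substᵗˢ-∘ : {σ : Fin l → Term L m} {τ : Fin m → Term L n} {υ : Fin l → Term L n} →
              (∀ i → substᵗ τ (σ i) ≡ υ i) →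
              ∀ (ts : Vec (Term L l) k) → substᵗˢ τ (substᵗˢ σ ts) ≡ substᵗˢ υ ts
  substᵗˢ-∘ e []       = refl
  substᵗˢ-∘ e (t ∷ ts) = cong₂ _∷_ (substᵗ-∘ e t) (substᵗˢ-∘ e ts)

substᵗ-renameᵗ : (σ : Fin m → Term L n) (ρ : Fin l → Fin m) →
                 ∀ t → substᵗ σ (renameᵗ ρ t) ≡ substᵗ (σ ∘ ρ) t
substᵗ-renameᵗ σ ρ t = trans (cong (substᵗ σ) (renameᵗ≡substᵗ (λ _ → refl) t))
                             (substᵗ-∘ (λ _ → refl) t)

renameᵗ-substᵗ : (ρ : Fin m → Fin n) (σ : Fin l → Term L m) →
                 ∀ t → renameᵗ ρ (substᵗ σ t) ≡ substᵗ (renameᵗ ρ ∘ σ) t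
renameᵗ-substᵗ ρ σ t = trans (renameᵗ≡substᵗ (λ _ → refl) (substᵗ σ t))
  (substᵗ-∘ (λ i → sym (renameᵗ≡substᵗ (λ _ → refl) (σ i))) t)

-- Terms bind nothing, so their composition law comes first and gives the two mixed laws above,
-- which move `τ` past the weakening under a binder.
liftˢ-∘ : {σ : Fin l → Term L m} {τ : Fin m → Term L n} {υ : Fin l → Term L n} →
          (∀ i → substᵗ τ (σ i) ≡ υ i) → ∀ i → substᵗ (liftˢ τ) (liftˢ σ i) ≡ liftˢ υ i
liftˢ-∘ e zero = refl
liftˢ-∘ {σ = σ} {τ} e (suc i) = trans (substᵗ-renameᵗ (liftˢ τ) suc (σ i))
  (trans (sym (renameᵗ-substᵗ suc τ (σ i))) (cong (renameᵗ suc) (e i)))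

subst-∘ : {σ : Fin l → Term L m} {τ : Fin m → Term L n} {υ : Fin l → Term L n} →
          (∀ i → substᵗ τ (σ i) ≡ υ i) → ∀ φ → subst τ (subst σ φ) ≡ subst υ φ
subst-∘ e (rel r ts) = cong (rel r) (substᵗˢ-∘ e ts)
subst-∘ e (s ≐ t)    = cong₂ _≐_ (substᵗ-∘ e s) (substᵗ-∘ e t)
subst-∘ e ⊥′         = refl
subst-∘ e (φ ⇒ ψ)    = cong₂ _⇒_ (subst-∘ e φ) (subst-∘ e ψ)
subst-∘ e (φ ∧ ψ)    = cong₂ _∧_ (subst-∘ e φ) (subst-∘ e ψ)
subst-∘ e (φ ∨ ψ)    = cong₂ _∨_ (subst-∘ e φ) (subst-∘ e ψ)
subst-∘ e (∀′ φ)     = cong ∀′_ (subst-∘ (liftˢ-∘ e) φ)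
subst-∘ e (∃′ φ)     = cong ∃′_ (subst-∘ (liftˢ-∘ e) φ)

subst-cong : {σ τ : Fin m → Term L n} → (∀ i → σ i ≡ τ i) → ∀ φ → subst σ φ ≡ subst τ φ
subst-cong {σ = σ} e φ = trans (sym (subst-id (λ _ → refl) (subst σ φ)))
  (subst-∘ (λ i → trans (substᵗ-id (λ _ → refl) (σ i)) (e i)) φ)

subst-rename : (σ : Fin m → Term L n) (ρ : Fin l → Fin m) →
               ∀ φ → subst σ (rename ρ φ) ≡ subst (σ ∘ ρ) φ
subst-rename σ ρ φ = trans (cong (subst σ) (rename≡subst (λ _ → refl) φ))
                           (subst-∘ (λ _ → refl) φ)

rename-subst : (ρ : Fin m → Fin n) (σ : Fin l → Term L m) →
               ∀ φ → rename ρ (subst σ φ) ≡ subst (renameᵗ ρ ∘ σ) φ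
rename-subst ρ σ φ = trans (rename≡subst (λ _ → refl) (subst σ φ))
  (subst-∘ (λ i → sym (renameᵗ≡substᵗ (λ _ → refl) (σ i))) φ)

rename-rename : {ρ : Fin l → Fin m} {ρ′ : Fin m → Fin n} {ρ″ : Fin l → Fin n} →
                (∀ i → ρ′ (ρ i) ≡ ρ″ i) →
                ∀ (φ : Formula L l) → rename ρ′ (rename ρ φ) ≡ rename ρ″ φ
rename-rename {ρ = ρ} {ρ′} e φ = trans (rename≡subst (λ _ → refl) (rename ρ φ))
  (trans (subst-rename (var ∘ ρ′) ρ φ) (sym (rename≡subst (λ i → cong var (sym (e i))) φ)))

rename-id : (φ : Formula L n) → rename id φ ≡ φ
rename-id φ = trans (rename≡subst (λ _ → refl) φ) (subst-id (λ _ → refl) φ)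

rename-wk : (ρ : Fin m → Fin n) (φ : Formula L m) → rename (lift 1 ρ) (wk φ) ≡ wk (rename ρ φ)
rename-wk ρ φ = trans (rename-rename (λ _ → refl) φ) (sym (rename-rename (λ _ → refl) φ))

rename-[] : (ρ : Fin m → Fin n) (φ : Formula L (suc m)) (t : Term L m) →
            rename ρ (φ [ t ]) ≡ rename (lift 1 ρ) φ [ renameᵗ ρ t ]
rename-[] ρ φ t = trans (rename-subst ρ (t ◂ var) φ)
  (trans (subst-cong (λ { zero → refl ; (suc i) → refl }) φ)
         (sym (subst-rename (renameᵗ ρ t ◂ var) (lift 1 ρ) φ)))

wk-[] : (φ : Formula L n) (t : Term L n) → wk φ [ t ] ≡ φ
wk-[] φ t = trans (subst-rename (t ◂ var) suc φ) (subst-id (λ _ → refl) φ)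

lift-suc-[v0] : (φ : Formula L (suc n)) → rename (lift 1 suc) φ [ v0 ] ≡ φ
lift-suc-[v0] φ = trans (subst-rename (v0 ◂ var) (lift 1 suc) φ)
                        (subst-id (λ { zero → refl ; (suc i) → refl }) φ)

-- Structural rules for derivations

∈-lift : {ρ : Fin m → Fin n} {Γ : List (Formula L m)} {Δ : List (Formula L n)} →
         (∀ {φ} → φ ∈ Γ → rename ρ φ ∈ Δ) →
         ∀ {φ} → φ ∈ map wk Γ → rename (lift 1 ρ) φ ∈ map wk Δ
∈-lift {ρ = ρ} s p with ∈-map⁻ wk p
... | φ , q , refl = ≡.subst (_∈ _) (sym (rename-wk ρ φ)) (∈-map⁺ wk (s q))

∈-∷ : {f : Formula L m → Formula L n} {φ : Formula L m}
      {Γ : List (Formula L m)} {Δ : List (Formula L n)} →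
      (∀ {ψ} → ψ ∈ Γ → f ψ ∈ Δ) → ∀ {ψ} → ψ ∈ φ ∷ Γ → f ψ ∈ f φ ∷ Δ
∈-∷ s (here refl) = here refl
∈-∷ s (there p)   = there (s p)

∈-insert : {φ ψ χ : Formula L n} {Γ : List (Formula L n)} → φ ∈ ψ ∷ Γ → φ ∈ ψ ∷ χ ∷ Γ
∈-insert (here e)  = here e
∈-insert (there p) = there (there p)

module _ {L : Language} {T : Theory L} where

  ⊢-cast : {Γ : List (Formula L n)} {φ ψ : Formula L n} → φ ≡ ψ → T ∣ Γ ⊢ φ → T ∣ Γ ⊢ ψ
  ⊢-cast refl d = d

  -- Asking only that renamed hypotheses belong to `Δ` makes one induction cover renaming,
  -- weakening, exchange and contraction.
  ⊢-rename : (ρ : Fin m → Fin n) {Γ : List (Formula L m)} {Δ : List (Formula L n)} →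
             (∀ {φ} → φ ∈ Γ → rename ρ φ ∈ Δ) →
             ∀ {φ} → T ∣ Γ ⊢ φ → T ∣ Δ ⊢ rename ρ φ
  ⊢-rename ρ s (axiom {φ} a) = ⊢-cast (sym (rename-rename (λ ()) φ)) (axiom a)
  ⊢-rename ρ s (hyp p)       = hyp (s p)
  ⊢-rename ρ s (raa d)       = raa (⊢-rename ρ (∈-∷ s) d)
  ⊢-rename ρ s (⇒-I d)       = ⇒-I (⊢-rename ρ (∈-∷ s) d)
  ⊢-rename ρ s (⇒-E d e)     = ⇒-E (⊢-rename ρ s d) (⊢-rename ρ s e)
  ⊢-rename ρ s (∧-I d e)     = ∧-I (⊢-rename ρ s d) (⊢-rename ρ s e)
  ⊢-rename ρ s (∧-E₁ d)      = ∧-E₁ (⊢-rename ρ s d)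
  ⊢-rename ρ s (∧-E₂ d)      = ∧-E₂ (⊢-rename ρ s d)
  ⊢-rename ρ s (∨-I₁ d)      = ∨-I₁ (⊢-rename ρ s d)
  ⊢-rename ρ s (∨-I₂ d)      = ∨-I₂ (⊢-rename ρ s d)
  ⊢-rename ρ s (∨-E d e f)   = ∨-E (⊢-rename ρ s d)
    (⊢-rename ρ (∈-∷ s) e) (⊢-rename ρ (∈-∷ s) f)
  ⊢-rename ρ s (∀-I d)       = ∀-I (⊢-rename (lift 1 ρ) (∈-lift s) d)
  ⊢-rename ρ s (∀-E {φ} d t) =
    ⊢-cast (sym (rename-[] ρ φ t)) (∀-E (⊢-rename ρ s d) (renameᵗ ρ t))
  ⊢-rename ρ s (∃-I {φ} t d) =
    ∃-I (renameᵗ ρ t) (⊢-cast (rename-[] ρ φ t) (⊢-rename ρ s d))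
  ⊢-rename ρ s (∃-E {ψ = ψ} d e) = ∃-E (⊢-rename ρ s d)
    (⊢-cast (rename-wk ρ ψ) (⊢-rename (lift 1 ρ) (∈-∷ (∈-lift s)) e))
  ⊢-rename ρ s (≐-I t)       = ≐-I (renameᵗ ρ t)
  ⊢-rename ρ s (≐-E φ {u} {t} d e) = ⊢-cast (sym (rename-[] ρ φ t))
    (≐-E (rename (lift 1 ρ) φ) (⊢-rename ρ s d)
      (⊢-cast (rename-[] ρ φ u) (⊢-rename ρ s e)))
  ⊢-rename ρ s dom           = dom

  ⊢-weaken : {Γ Δ : List (Formula L n)} → (∀ {φ} → φ ∈ Γ → φ ∈ Δ) →
             ∀ {φ} → T ∣ Γ ⊢ φ → T ∣ Δ ⊢ φ
  ⊢-weaken s d = ⊢-cast (rename-id _)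
    (⊢-rename id (λ {φ} p → ≡.subst (_∈ _) (sym (rename-id φ)) (s p)) d)

  ⊢-wk : {Γ : List (Formula L n)} → ∀ {φ} → T ∣ Γ ⊢ φ → T ∣ map wk Γ ⊢ wk φ
  ⊢-wk = ⊢-rename suc (∈-map⁺ wk)

  -- The Henkin axiom for `∀′`, in the form of the drinker principle: a variable where `χ` fails is
  -- a witness vacuously, and if there is none, any variable will do. The scope `suc n` guarantees
  -- that there is one.
  ∃-drinker : {Γ : List (Formula L (suc n))} (χ : Formula L (suc (suc n))) →
              T ∣ Γ ⊢ ∃′ (χ ⇒ wk (∀′ χ))
  ∃-drinker {n} {Γ} χ = raa (⇒-E (hyp (here refl)) (∃-I v0 (⇒-I
      (⊢-cast (sym (wk-[] (∀′ χ) v0)) (∀-I (raa contra))))))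
    where
    δ : Formula L (suc (suc n))
    δ = χ ⇒ wk (∀′ χ)
    contra : T ∣ ¬′ χ ∷ wk (χ [ v0 ]) ∷ wk (¬′ (∃′ δ)) ∷ map wk Γ ⊢ ⊥′
    contra = ⇒-E (hyp (there (there (here refl)))) (∃-I v0 (⊢-cast (sym (lift-suc-[v0] δ))
      (⇒-I (raa (⇒-E (hyp (there (there (here refl)))) (hyp (there (here refl))))))))

-- Completeness

infix 1 _↔_
_↔_ : Set → Set → Set
A ↔ C = (A → C) × (C → A)

-- Double negation relative to `R`, and models

module Continuation (R : Set) where

  -- A record rather than a synonym, so that `A` can be inferred and instance search does not take
  -- it for a function type.
  record ⟪_⟫ (A : Set) : Set where
    constructor cont
    field run : (A → R) → R
  open ⟪_⟫ public

  record Stable (A : Set) : Set where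
    field stable : ⟪ A ⟫ → A
  open Stable {{...}} public

  private variable
    A C : Set

  infixl 1 _>>=_
  _>>=_ : {{Stable C}} → ⟪ A ⟫ → (A → C) → C
  m >>= f = stable (cont λ k → run m λ a → k (f a))

  return : A → ⟪ A ⟫
  return a = cont λ k → k a

  explode : {{Stable A}} → R → A
  explode r = stable (cont λ _ → r)

  lem : ∀ A → ⟪ A ⊎ (A → R) ⟫
  lem A = cont λ k → k (inj₂ λ a → k (inj₁ a))

  by-contra : {{Stable A}} → ((A → R) → R) → A
  by-contra f = stable (cont f)

  instance
    stable-⟪⟫ : Stable ⟪ A ⟫
    stable-⟪⟫ = record { stable = λ m → cont λ k → run m λ m′ → run m′ k }

    stable-R : Stable R
    stable-R = record { stable = λ m → run m id }

    stable-Π : {P : A → Set} → {{∀ {x} → Stable (P x)}} → Stable (∀ x → P x)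
    stable-Π = record { stable = λ m x → stable (cont λ k → run m λ f → k (f x)) }

    stable-× : {{Stable A}} → {{Stable C}} → Stable (A × C)
    stable-× = record { stable = λ m → stable (cont λ k → run m λ p → k (proj₁ p))
                                     , stable (cont λ k → run m λ p → k (proj₂ p)) }

record Interpretation (L : Language) (R : Set) : Set₁ where
  field
    D    : Set
    relI : Rel L k → Vec D k → Set
    eqI  : D → D → Set
    funI : Fun L k → Vec D k → D

  open Continuation R

  mutual
    eval : Term L n → (Fin n → D) → D
    eval (var x)    σ = σ x
    eval (fun f ts) σ = funI f (evals ts σ)

    evals : Vec (Term L n) k → (Fin n → D) → Vec D k
    evals []       σ = []
    evals (t ∷ ts) σ = eval t σ ∷ evals ts σ

  ⟦_⟧ : Formula L n → (Fin n → D) → Set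
  ⟦ rel r ts ⟧ σ = relI r (evals ts σ)
  ⟦ s ≐ t ⟧    σ = eqI (eval s σ) (eval t σ)
  ⟦ ⊥′ ⟧       σ = R
  ⟦ φ ⇒ ψ ⟧    σ = ⟦ φ ⟧ σ → ⟦ ψ ⟧ σ
  ⟦ φ ∧ ψ ⟧    σ = ⟦ φ ⟧ σ × ⟦ ψ ⟧ σ
  ⟦ φ ∨ ψ ⟧    σ = ⟪ ⟦ φ ⟧ σ ⊎ ⟦ ψ ⟧ σ ⟫
  ⟦ ∀′ φ ⟧     σ = ∀ d → ⟦ φ ⟧ (d ◂ σ)
  ⟦ ∃′ φ ⟧     σ = ⟪ Σ[ d ∈ D ] ⟦ φ ⟧ (d ◂ σ) ⟫

  mutual
    eval-subst : {τ : Fin m → Term L n} {σ : Fin n → D} {σ′ : Fin m → D} →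
                 (∀ i → eval (τ i) σ ≡ σ′ i) → ∀ t → eval (substᵗ τ t) σ ≡ eval t σ′
    eval-subst e (var x)    = e x
    eval-subst e (fun f ts) = cong (funI f) (evals-subst e ts)

    evals-subst : {τ : Fin m → Term L n} {σ : Fin n → D} {σ′ : Fin m → D} →
                  (∀ i → eval (τ i) σ ≡ σ′ i) →
                  ∀ (ts : Vec (Term L m) k) → evals (substᵗˢ τ ts) σ ≡ evals ts σ′
    evals-subst e []       = refl
    evals-subst e (t ∷ ts) = cong₂ _∷_ (eval-subst e t) (evals-subst e ts)

  eval-liftˢ : {τ : Fin m → Term L n} {σ : Fin n → D} {σ′ : Fin m → D} →
               (∀ i → eval (τ i) σ ≡ σ′ i) →
               ∀ d i → eval (liftˢ τ i) (d ◂ σ) ≡ (d ◂ σ′) i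
  eval-liftˢ e d zero = refl
  eval-liftˢ {τ = τ} {σ} e d (suc i) =
    trans (cong (λ t → eval t (d ◂ σ)) (renameᵗ≡substᵗ (λ _ → refl) (τ i)))
          (trans (eval-subst (λ _ → refl) (τ i)) (e i))

  mutual
    ⟦subst⟧→ : {τ : Fin m → Term L n} {σ : Fin n → D} {σ′ : Fin m → D} →
               (∀ i → eval (τ i) σ ≡ σ′ i) → ∀ φ → ⟦ subst τ φ ⟧ σ → ⟦ φ ⟧ σ′
    ⟦subst⟧→ e (rel r ts) p = ≡.subst (relI r) (evals-subst e ts) p
    ⟦subst⟧→ e (s ≐ t)    p = ≡.subst₂ eqI (eval-subst e s) (eval-subst e t) p
    ⟦subst⟧→ e ⊥′         p = p
    ⟦subst⟧→ e (φ ⇒ ψ)    p = ⟦subst⟧→ e ψ ∘ p ∘ ⟦subst⟧← e φ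
    ⟦subst⟧→ e (φ ∧ ψ)    (p , q) = ⟦subst⟧→ e φ p , ⟦subst⟧→ e ψ q
    ⟦subst⟧→ e (φ ∨ ψ)    p = p >>= λ where
      (inj₁ q) → return (inj₁ (⟦subst⟧→ e φ q))
      (inj₂ q) → return (inj₂ (⟦subst⟧→ e ψ q))
    ⟦subst⟧→ e (∀′ φ)     p d = ⟦subst⟧→ (eval-liftˢ e d) φ (p d)
    ⟦subst⟧→ e (∃′ φ)     p = p >>= λ (d , q) → return (d , ⟦subst⟧→ (eval-liftˢ e d) φ q)

    ⟦subst⟧← : {τ : Fin m → Term L n} {σ : Fin n → D} {σ′ : Fin m → D} →
               (∀ i → eval (τ i) σ ≡ σ′ i) → ∀ φ → ⟦ φ ⟧ σ′ → ⟦ subst τ φ ⟧ σ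
    ⟦subst⟧← e (rel r ts) p = ≡.subst (relI r) (sym (evals-subst e ts)) p
    ⟦subst⟧← e (s ≐ t)    p = ≡.subst₂ eqI (sym (eval-subst e s)) (sym (eval-subst e t)) p
    ⟦subst⟧← e ⊥′         p = p
    ⟦subst⟧← e (φ ⇒ ψ)    p = ⟦subst⟧← e ψ ∘ p ∘ ⟦subst⟧→ e φ
    ⟦subst⟧← e (φ ∧ ψ)    (p , q) = ⟦subst⟧← e φ p , ⟦subst⟧← e ψ q
    ⟦subst⟧← e (φ ∨ ψ)    p = p >>= λ where
      (inj₁ q) → return (inj₁ (⟦subst⟧← e φ q))
      (inj₂ q) → return (inj₂ (⟦subst⟧← e ψ q))
    ⟦subst⟧← e (∀′ φ)     p d = ⟦subst⟧← (eval-liftˢ e d) φ (p d)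
    ⟦subst⟧← e (∃′ φ)     p = p >>= λ (d , q) → return (d , ⟦subst⟧← (eval-liftˢ e d) φ q)

  ⟦subst⟧ : {τ : Fin m → Term L n} {σ : Fin n → D} {σ′ : Fin m → D} →
            (∀ i → eval (τ i) σ ≡ σ′ i) → ∀ φ → ⟦ subst τ φ ⟧ σ ↔ ⟦ φ ⟧ σ′
  ⟦subst⟧ e φ = ⟦subst⟧→ e φ , ⟦subst⟧← e φ

  ⟦rename⟧ : {ρ : Fin m → Fin n} {σ : Fin n → D} {σ′ : Fin m → D} →
             (∀ i → σ (ρ i) ≡ σ′ i) → ∀ φ → ⟦ rename ρ φ ⟧ σ ↔ ⟦ φ ⟧ σ′
  ⟦rename⟧ {σ = σ} e φ =
    ≡.subst (λ ψ → ⟦ ψ ⟧ σ ↔ _) (sym (rename≡subst (λ _ → refl) φ)) (⟦subst⟧ e φ)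

  ⟦⟧-cong : {σ τ : Fin n → D} → (∀ i → σ i ≡ τ i) → ∀ φ → ⟦ φ ⟧ σ → ⟦ φ ⟧ τ
  ⟦⟧-cong {σ = σ} e φ p = proj₁ (⟦subst⟧ {τ = var} e φ)
    (≡.subst (λ ψ → ⟦ ψ ⟧ σ) (sym (subst-id (λ _ → refl) φ)) p)

  ⟦∀*⟧→ : ∀ n (φ : Formula L n) {σ₀} → ⟦ ∀* n φ ⟧ σ₀ → ∀ σ → ⟦ φ ⟧ σ
  ⟦∀*⟧→ zero    φ p σ = ⟦⟧-cong (λ ()) φ p
  ⟦∀*⟧→ (suc n) φ p σ = ⟦⟧-cong (λ { zero → refl ; (suc _) → refl }) φ
    (⟦∀*⟧→ n (∀′ φ) p (σ ∘ suc) (σ zero))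

  ⟦∀*⟧← : ∀ n (φ : Formula L n) → (∀ σ → ⟦ φ ⟧ σ) → ∀ σ₀ → ⟦ ∀* n φ ⟧ σ₀
  ⟦∀*⟧← zero    φ p σ = p σ
  ⟦∀*⟧← (suc n) φ p σ = ⟦∀*⟧← n (∀′ φ) (λ τ d → p (d ◂ τ)) σ

-- Equality is a congruence instead of `_≡_` because in the term model it is provable equality, and
-- no quotient is formed. Stability licenses classical reasoning about formulas.
record Model (T : Theory L) (R : Set) : Set₁ where
  field interpretation : Interpretation L R
  open Interpretation interpretation public
  open Continuation R
  field
    ⟦⟧-stable : (φ : Formula L n) (σ : Fin n → D) → Stable (⟦ φ ⟧ σ)
    ≐-refl    : ∀ d → eqI d d
    ≐-subst   : (φ : Formula L (suc n)) (σ : Fin n → D) {d e : D} →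
                eqI d e → ⟦ φ ⟧ (d ◂ σ) → ⟦ φ ⟧ (e ◂ σ)
    sound     : ∀ {φ} → T φ → ∀ σ → ⟦ φ ⟧ σ

-- Enumeration of pairs along antidiagonals, and of binary trees

next : ℕ × ℕ → ℕ × ℕ
next (a , zero)  = zero , suc a
next (a , suc b) = suc a , b

unpair : ℕ → ℕ × ℕ
unpair zero    = 0 , 0
unpair (suc i) = next (unpair i)

unpair-surjective : ∀ a b → Σ[ i ∈ ℕ ] unpair i ≡ (a , b)
unpair-surjective a b = go (a + b) a b refl
  where
  go : ∀ s a b → a + b ≡ s → Σ[ i ∈ ℕ ] unpair i ≡ (a , b)
  go s       (suc a) b       e with go s a (suc b) (trans (+-suc a b) e)
  ... | i , p = suc i , cong next p
  go s       zero    zero    e = 0 , refl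
  go (suc s) zero    (suc b) refl with go s b zero (+-identityʳ b)
  ... | i , p = suc i , cong next p

unpair-bounded : ∀ i → proj₁ (unpair i) + proj₂ (unpair i) ≤ i
unpair-bounded zero = z≤n
unpair-bounded (suc i) with unpair i | unpair-bounded i
... | a , zero  | p = s≤s (≡.subst (_≤ i) (+-identityʳ a) p)
... | a , suc b | p = ≤-trans (≡.subst (_≤ i) (+-suc a b) p) (n≤1+n i)

data Tree : Set where
  leaf : Tree
  node : Tree → Tree → Tree

private
  -- The first argument is fuel.
  tree : ℕ → ℕ → Tree
  tree zero    i       = leaf
  tree (suc f) zero    = leaf
  tree (suc f) (suc i) = node (tree f (proj₁ (unpair i))) (tree f (proj₂ (unpair i)))

  tree-surjective : ∀ t → Σ[ f ∈ ℕ ] Σ[ i ∈ ℕ ] ∀ {g} → f ≤ g → tree g i ≡ t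
  tree-surjective leaf = 0 , 0 , λ { {zero} _ → refl ; {suc _} _ → refl }
  tree-surjective (node s t) with tree-surjective s | tree-surjective t
  ... | f , i , p | f′ , i′ , p′ with unpair-surjective i i′
  ... | j , q = suc (f ⊔ f′) , suc j , λ { {suc g} (s≤s f≤g) → cong₂ node
      (trans (cong (tree g ∘ proj₁) q) (p (≤-trans (m≤m⊔n f f′) f≤g)))
      (trans (cong (tree g ∘ proj₂) q) (p′ (≤-trans (m≤n⊔m f f′) f≤g))) }

abstract
  enumerate : ℕ → Tree
  enumerate i = tree (proj₁ (unpair (proj₁ (unpair i)))) (proj₂ (unpair (proj₁ (unpair i))))

  -- The number `i` unpairs into fuel and code of the tree on one side and `J` on the other, the
  -- latter as padding that pushes `i` up to `J`. Henkin's construction needs every formula to turn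
  -- up after all its names have been introduced.
  enumerate-cofinal : ∀ t J → Σ[ i ∈ ℕ ] (J ≤ i × enumerate i ≡ t)
  enumerate-cofinal t J with tree-surjective t
  ... | f , c , p with unpair-surjective f c
  ... | d , q with unpair-surjective d J
  ... | i , r = i , ≤-trans (m≤n+m J d) (≡.subst (λ x → proj₁ x + proj₂ x ≤ i) r (unpair-bounded i)) ,
    trans (cong (λ x → tree (proj₁ (unpair (proj₁ x))) (proj₂ (unpair (proj₁ x)))) r)
          (trans (cong (λ x → tree (proj₁ x) (proj₂ x)) q) (p ≤-refl))

-- Coding of formulas by trees

record Countable (L : Language) : Set where
  field
    relation  : Tree → Σ[ k ∈ ℕ ] Rel L k
    relation⁻ : ∀ {k} (r : Rel L k) → Σ[ t ∈ Tree ] relation t ≡ (k , r)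
    function  : Tree → Σ[ k ∈ ℕ ] Fun L k
    function⁻ : ∀ {k} (f : Fun L k) → Σ[ t ∈ Tree ] function t ≡ (k , f)

toTree : ℕ → Tree
toTree zero    = leaf
toTree (suc n) = node leaf (toTree n)

toℕᵀ : Tree → ℕ
toℕᵀ leaf       = zero
toℕᵀ (node _ t) = suc (toℕᵀ t)

toℕᵀ-toTree : ∀ n → toℕᵀ (toTree n) ≡ n
toℕᵀ-toTree zero    = refl
toℕᵀ-toTree (suc n) = cong suc (toℕᵀ-toTree n)

-- `name x` is the constant that Henkin's construction introduces at stage x.
data Named (L : Language) : Set where
  name : ℕ → Named L
  fun  : Fun L k → Vec (Named L) k → Named L

mutual
  place : (ℕ → Fin n) → Named L → Term L n
  place ν (name x)   = var (ν x)
  place ν (fun f ds) = fun f (places ν ds)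

  places : (ℕ → Fin n) → Vec (Named L) k → Vec (Term L n) k
  places ν []       = []
  places ν (d ∷ ds) = place ν d ∷ places ν ds

mutual
  shift : Named L → Named L
  shift (name x)   = name (suc x)
  shift (fun f ds) = fun f (shifts ds)

  shifts : Vec (Named L) k → Vec (Named L) k
  shifts []       = []
  shifts (d ∷ ds) = shift d ∷ shifts ds

underᴺ : (ℕ → Fin n) → ℕ → Fin (suc n)
underᴺ ν zero    = zero
underᴺ ν (suc x) = suc (ν x)

mutual
  place-shift : (ν : ℕ → Fin n) (d : Named L) → place (underᴺ ν) (shift d) ≡ renameᵗ suc (place ν d)
  place-shift ν (name x)   = refl
  place-shift ν (fun f ds) = cong (fun f) (places-shifts ν ds)

  places-shifts : (ν : ℕ → Fin n) (ds : Vec (Named L) k) →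
                  places (underᴺ ν) (shifts ds) ≡ renameᵗˢ suc (places ν ds)
  places-shifts ν []       = refl
  places-shifts ν (d ∷ ds) = cong₂ _∷_ (place-shift ν d) (places-shifts ν ds)

named : {R : Set} → (∀ {k} → Rel L k → Vec (Named L) k → Set) → (Named L → Named L → Set) →
        Interpretation L R
named {L} r e = record { D = Named L ; relI = r ; eqI = e ; funI = fun }

module _ {L : Language} {R : Set} {r : ∀ {k} → Rel L k → Vec (Named L) k → Set}
         {e : Named L → Named L → Set} where
  open Interpretation (named {R = R} r e)

  mutual
    place-eval : (ν : ℕ → Fin m) (t : Term L n) (σ : Fin n → Named L) →
                 place ν (eval t σ) ≡ substᵗ (place ν ∘ σ) t
    place-eval ν (var x)    σ = refl
    place-eval ν (fun f ts) σ = cong (fun f) (places-evals ν ts σ)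

    places-evals : (ν : ℕ → Fin m) (ts : Vec (Term L n) k) (σ : Fin n → Named L) →
                   places ν (evals ts σ) ≡ substᵗˢ (place ν ∘ σ) ts
    places-evals ν []       σ = refl
    places-evals ν (t ∷ ts) σ = cong₂ _∷_ (place-eval ν t σ) (places-evals ν ts σ)

module Coding {L : Language} (C : Countable L) where
  open Countable C
  open Interpretation (named {L} {⊤} (λ _ _ → ⊤) (λ _ _ → ⊤)) using (eval; evals)

  mutual
    decodeᵗ : Tree → (ℕ → Fin n) → Term L n
    decodeᵗ leaf                 ν = var (ν 0)
    decodeᵗ (node leaf t)        ν = var (ν (toℕᵀ t))
    decodeᵗ (node (node f _) ts) ν = fun (proj₂ (function f)) (decodeᵗˢ (proj₁ (function f)) ts ν)

    decodeᵗˢ : ∀ k → Tree → (ℕ → Fin n) → Vec (Term L n) k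
    decodeᵗˢ zero    t           ν = []
    decodeᵗˢ (suc k) leaf        ν = replicate (suc k) (var (ν 0))
    decodeᵗˢ (suc k) (node t ts) ν = decodeᵗ t ν ∷ decodeᵗˢ k ts ν

  -- A tree has no scope of its own: its free variables are names, which `ν` places in any scope. So
  -- one tree can be read both as a formula of a stage and, with name 0 as the bound variable, as a
  -- body under a quantifier. Trees that encode nothing decode to harmless junk.
  decode : Tree → (ℕ → Fin n) → Formula L n
  decode (node leaf (node r ts)) ν = rel (proj₂ (relation r)) (decodeᵗˢ (proj₁ (relation r)) ts ν)
  decode (node (node leaf leaf) (node s t)) ν = decodeᵗ s ν ≐ decodeᵗ t ν
  decode (node (node leaf (node leaf leaf)) (node s t)) ν = decode s ν ⇒ decode t ν
  decode (node (node leaf (node leaf (node leaf leaf))) (node s t)) ν = decode s ν ∧ decode t ν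
  decode (node (node leaf (node leaf (node leaf (node leaf _)))) (node s t)) ν = decode s ν ∨ decode t ν
  decode (node (node (node _ _) leaf) t) ν = ∀′ decode t (underᴺ ν)
  decode (node (node (node _ _) (node _ _)) t) ν = ∃′ decode t (underᴺ ν)
  decode _ ν = ⊥′

  mutual
    encodeᵗ : Named L → Tree
    encodeᵗ (name x)   = node leaf (toTree x)
    encodeᵗ (fun f ds) = node (node (proj₁ (function⁻ f)) leaf) (encodeᵗˢ ds)

    encodeᵗˢ : Vec (Named L) k → Tree
    encodeᵗˢ []       = leaf
    encodeᵗˢ (d ∷ ds) = node (encodeᵗ d) (encodeᵗˢ ds)

  mutual
    decodeᵗ-encodeᵗ : ∀ d (ν : ℕ → Fin n) → decodeᵗ (encodeᵗ d) ν ≡ place ν d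
    decodeᵗ-encodeᵗ (name x)   ν = cong (var ∘ ν) (toℕᵀ-toTree x)
    decodeᵗ-encodeᵗ (fun f ds) ν with function (proj₁ (function⁻ f)) | proj₂ (function⁻ f)
    ... | _ | refl = cong (fun f) (decodeᵗˢ-encodeᵗˢ ds ν)

    decodeᵗˢ-encodeᵗˢ : ∀ (ds : Vec (Named L) k) (ν : ℕ → Fin n) →
                        decodeᵗˢ k (encodeᵗˢ ds) ν ≡ places ν ds
    decodeᵗˢ-encodeᵗˢ []       ν = refl
    decodeᵗˢ-encodeᵗˢ (d ∷ ds) ν = cong₂ _∷_ (decodeᵗ-encodeᵗ d ν) (decodeᵗˢ-encodeᵗˢ ds ν)

  under : (Fin n → Named L) → Fin (suc n) → Named L
  under σ = name 0 ◂ (shift ∘ σ)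

  encode : Formula L n → (Fin n → Named L) → Tree
  encode (rel r ts) σ = node leaf (node (proj₁ (relation⁻ r)) (encodeᵗˢ (evals ts σ)))
  encode (s ≐ t)    σ = node (node leaf leaf) (node (encodeᵗ (eval s σ)) (encodeᵗ (eval t σ)))
  encode ⊥′         σ = leaf
  encode (φ ⇒ ψ)    σ = node (node leaf (node leaf leaf)) (node (encode φ σ) (encode ψ σ))
  encode (φ ∧ ψ)    σ = node (node leaf (node leaf (node leaf leaf))) (node (encode φ σ) (encode ψ σ))
  encode (φ ∨ ψ)    σ = node (node leaf (node leaf (node leaf (node leaf leaf)))) (node (encode φ σ) (encode ψ σ))
  encode (∀′ φ)     σ = node (node (node leaf leaf) leaf) (encode φ (under σ))
  encode (∃′ φ)     σ = node (node (node leaf leaf) (node leaf leaf)) (encode φ (under σ))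

  place-under : (ν : ℕ → Fin m) (σ : Fin n → Named L) →
                ∀ i → place (underᴺ ν) (under σ i) ≡ liftˢ (place ν ∘ σ) i
  place-under ν σ zero    = refl
  place-under ν σ (suc i) = place-shift ν (σ i)

  decode-encode : ∀ φ (σ : Fin n → Named L) (ν : ℕ → Fin m) →
                  decode (encode φ σ) ν ≡ subst (place ν ∘ σ) φ
  decode-encode (rel r ts) σ ν with relation (proj₁ (relation⁻ r)) | proj₂ (relation⁻ r)
  ... | _ | refl = cong (rel r) (trans (decodeᵗˢ-encodeᵗˢ (evals ts σ) ν) (places-evals ν ts σ))
  decode-encode (s ≐ t)    σ ν = cong₂ _≐_
    (trans (decodeᵗ-encodeᵗ (eval s σ) ν) (place-eval ν s σ))
    (trans (decodeᵗ-encodeᵗ (eval t σ) ν) (place-eval ν t σ))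
  decode-encode ⊥′         σ ν = refl
  decode-encode (φ ⇒ ψ)    σ ν = cong₂ _⇒_ (decode-encode φ σ ν) (decode-encode ψ σ ν)
  decode-encode (φ ∧ ψ)    σ ν = cong₂ _∧_ (decode-encode φ σ ν) (decode-encode ψ σ ν)
  decode-encode (φ ∨ ψ)    σ ν = cong₂ _∨_ (decode-encode φ σ ν) (decode-encode ψ σ ν)
  decode-encode (∀′ φ)     σ ν = cong ∀′_
    (trans (decode-encode φ (under σ) (underᴺ ν)) (subst-cong (place-under ν σ) φ))
  decode-encode (∃′ φ)     σ ν = cong ∃′_
    (trans (decode-encode φ (under σ) (underᴺ ν)) (subst-cong (place-under ν σ) φ))

-- The variable of stage i that stands for `name x`, for x ≤ i; larger names are junk.
stageVar : ∀ i → ℕ → Fin (suc i)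
stageVar zero    x = zero
stageVar (suc i) x with x ≟ suc i
... | yes _ = zero
... | no  _ = suc (stageVar i x)

stageVar-new : ∀ i → stageVar (suc i) (suc i) ≡ zero
stageVar-new i with suc i ≟ suc i
... | yes _ = refl
... | no ¬p = contradiction refl ¬p

stageVar-old : ∀ {i x} → x ≤ i → stageVar (suc i) x ≡ suc (stageVar i x)
stageVar-old {i} {x} x≤i with x ≟ suc i
... | yes refl = contradiction refl (<⇒≢ x≤i)
... | no  _    = refl

-- Henkin's construction

module Completeness {L : Language} (C : Countable L) (T : Theory L) (φ₀ : Sentence L) where
  open Coding C

  R : Set
  R = T ⊢ φ₀

  open Continuation R

  _⊩_ : (Formula L n → Set) → Formula L n → Set
  P ⊩ φ = Σ[ Γ ∈ List _ ] All P Γ × (T ∣ Γ ⊢ φ)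

  conjecture : ∀ i → Formula L (suc i)
  conjecture i = decode (enumerate i) (stageVar i)

  matrix : ∀ i → Formula L (suc (suc i))
  matrix i = decode (enumerate i) (underᴺ (stageVar i))

  -- `decide` adds a formula on the condition that this is conservative for ⊥′, so it need not be
  -- decided whether the condition holds.
  data Extend (i : ℕ) (P : Formula L (suc i) → Set) : Formula L (suc (suc i)) → Set where
    keep    : ∀ {φ} → P φ → Extend i P (wk φ)
    witness : Extend i P (matrix i ⇒ wk (∀′ matrix i))
    decide  : (∀ {Δ} → All P Δ → T ∣ conjecture i ∷ Δ ⊢ ⊥′ → P ⊩ ⊥′) →
              Extend i P (wk (conjecture i))

  data Initial : Formula L 1 → Set where
    refute : Initial (wk (¬′ φ₀))

  Stage : ∀ i → Formula L (suc i) → Set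
  Stage zero    = Initial
  Stage (suc i) = Extend i (Stage i)

  module _ {i : ℕ} {P : Formula L (suc i) → Set} where

    -- A derivation can only use finitely many formulas, so it tells whether it uses `decide`.
    split : ∀ {Γ} → All (Extend i P) Γ →
            Σ[ Δ ∈ List _ ] All P Δ ×
              ((∀ {φ} → φ ∈ Γ → φ ∈ (matrix i ⇒ wk (∀′ matrix i)) ∷ map wk Δ)
              ⊎ ((∀ {Δ} → All P Δ → T ∣ conjecture i ∷ Δ ⊢ ⊥′ → P ⊩ ⊥′) ×
                 (∀ {φ} → φ ∈ Γ → φ ∈ (matrix i ⇒ wk (∀′ matrix i)) ∷ wk (conjecture i) ∷ map wk Δ)))
    split [] = [] , [] , inj₁ λ ()
    split (p ∷ ps) with split ps
    split (keep {φ} p ∷ _) | Δ , q , inj₁ s = φ ∷ Δ , p ∷ q , inj₁ λ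
      { (here refl) → there (here refl) ; (there r) → ∈-insert (s r) }
    split (keep {φ} p ∷ _) | Δ , q , inj₂ (d , s) = φ ∷ Δ , p ∷ q , inj₂ (d , λ
      { (here refl) → there (there (here refl)) ; (there r) → ∈-∷ {f = id} ∈-insert (s r) })
    split (witness ∷ _) | Δ , q , inj₁ s = Δ , q , inj₁ λ
      { (here refl) → here refl ; (there r) → s r }
    split (witness ∷ _) | Δ , q , inj₂ (d , s) = Δ , q , inj₂ (d , λ
      { (here refl) → here refl ; (there r) → s r })
    split (decide d ∷ _) | Δ , q , inj₁ s = Δ , q , inj₂ (d , λ
      { (here refl) → there (here refl) ; (there r) → ∈-insert (s r) })
    split (decide _ ∷ _) | Δ , q , inj₂ (d , s) = Δ , q , inj₂ (d , λ
      { (here refl) → there (here refl) ; (there r) → s r })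

    -- The newest variable occurs only in the witness formula, so `∃-drinker` eliminates both. What
    -- is left is an inconsistency of `Δ`, or one of `Δ` with `conjecture i`; the latter is just
    -- what the condition stored in `decide` handles.
    extend-conservative : Extend i P ⊩ ⊥′ → P ⊩ ⊥′
    extend-conservative (Γ , ps , d) with split ps
    ... | Δ , q , inj₁ s       = Δ , q , ∃-E (∃-drinker (matrix i)) (⊢-weaken s d)
    ... | Δ , q , inj₂ (c , s) = c q (∃-E (∃-drinker (matrix i)) (⊢-weaken s d))

  -- Stage 0 has a variable in scope, as `∃-drinker` demands; `dom` discharges it, and `raa` turns
  -- the refutation of `¬′ φ₀` into an element of `R`.
  initial-consistent : Initial ⊩ ⊥′ → R
  initial-consistent (Γ , ps , d) = raa (∃-E dom (⊢-weaken (λ p → there (s ps p)) d))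
    where
    s : ∀ {Γ φ} → All Initial Γ → φ ∈ Γ → φ ∈ wk (¬′ φ₀) ∷ []
    s (refute ∷ _) (here refl) = here refl
    s (_ ∷ ps)     (there p)   = s ps p

  stage-consistent : ∀ i → Stage i ⊩ ⊥′ → R
  stage-consistent zero    = initial-consistent
  stage-consistent (suc i) = stage-consistent i ∘ extend-conservative

  module _ {P : Formula L n → Set} where
    private variable φ ψ χ : Formula L n

    ⊩-return : P φ → P ⊩ φ
    ⊩-return p = _ ∷ [] , p ∷ [] , hyp (here refl)

    ⊩-theorem : T ∣ [] ⊢ φ → P ⊩ φ
    ⊩-theorem d = [] , [] , d

    ⊩-map : (∀ {Γ} → T ∣ Γ ⊢ φ → T ∣ Γ ⊢ ψ) → P ⊩ φ → P ⊩ ψ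
    ⊩-map f (Γ , p , d) = Γ , p , f d

    ⊩-map₂ : (∀ {Γ} → T ∣ Γ ⊢ φ → T ∣ Γ ⊢ ψ → T ∣ Γ ⊢ χ) → P ⊩ φ → P ⊩ ψ → P ⊩ χ
    ⊩-map₂ f (Γ , p , d) (Δ , q , e) = Γ ++ Δ , ++⁺ p q ,
      f (⊢-weaken ∈-++⁺ˡ d) (⊢-weaken (∈-++⁺ʳ Γ) e)

  ⊩-keep : ∀ {i} {φ : Formula L (suc i)} → Stage i ⊩ φ → Stage (suc i) ⊩ wk φ
  ⊩-keep (Γ , p , d) = map wk Γ , map⁺ (All.map keep p) , ⊢-wk d

  Env : ℕ → Set
  Env n = Fin n → Named L

  none : Env 0
  none ()

  at : ∀ i → Env n → Fin n → Term L (suc i)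
  at i σ = place (stageVar i) ∘ σ

  mutual
    bound : Named L → ℕ
    bound (name x)   = x
    bound (fun f ds) = bounds ds

    bounds : Vec (Named L) k → ℕ
    bounds []       = 0
    bounds (d ∷ ds) = bound d ⊔ bounds ds

  boundᴱ : ∀ {n} → Env n → ℕ
  boundᴱ {zero}  σ = 0
  boundᴱ {suc n} σ = bound (σ zero) ⊔ boundᴱ (σ ∘ suc)

  mutual
    place-keep : ∀ {i} d → bound d ≤ i →
                 renameᵗ suc (place (stageVar i) d) ≡ place (stageVar (suc i)) d
    place-keep (name x)   b = cong var (sym (stageVar-old b))
    place-keep (fun f ds) b = cong (fun f) (places-keep ds b)

    places-keep : ∀ {i} (ds : Vec (Named L) k) → bounds ds ≤ i →
                  renameᵗˢ suc (places (stageVar i) ds) ≡ places (stageVar (suc i)) ds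
    places-keep []       b = refl
    places-keep (d ∷ ds) b = cong₂ _∷_ (place-keep d (≤-trans (m≤m⊔n _ _) b))
                                       (places-keep ds (≤-trans (m≤n⊔m (bound d) _) b))

  at-keep : ∀ {n i} (σ : Env n) → boundᴱ σ ≤ i → ∀ x → renameᵗ suc (at i σ x) ≡ at (suc i) σ x
  at-keep {suc n} σ b zero    = place-keep (σ zero) (≤-trans (m≤m⊔n _ _) b)
  at-keep {suc n} σ b (suc x) = at-keep (σ ∘ suc) (≤-trans (m≤n⊔m (bound (σ zero)) _) b) x

  wk-at : ∀ {n i} (φ : Formula L n) (σ : Env n) → boundᴱ σ ≤ i →
          wk (subst (at i σ) φ) ≡ subst (at (suc i) σ) φ
  wk-at φ σ b = trans (rename-subst suc _ φ) (subst-cong (at-keep σ b) φ)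

  -- A formula about a name is junk before the stage that introduces the name, so only late stages
  -- count.
  Eventually : (∀ i → Formula L (suc i)) → Set
  Eventually χ = Σ[ J ∈ ℕ ] (∀ {i} → J ≤ i → Stage i ⊩ χ i)

  record True (φ : Formula L n) (σ : Env n) : Set where
    constructor truth
    field eventually : Eventually λ i → subst (at i σ) φ
  open True

  module _ {φ : Formula L n} {σ : Env n} where

    true-from : ∀ {i} → boundᴱ σ ≤ i → Stage i ⊩ subst (at i σ) φ → True φ σ
    true-from {i} b p = truth (i , λ i≤j → go (≤⇒≤′ i≤j))
      where
      go : ∀ {j} → i ≤′ j → Stage j ⊩ subst (at j σ) φ
      go ≤′-refl = p
      go (≤′-step i≤j) = ≡.subst (_ ⊩_) (wk-at φ σ (≤-trans b (≤′⇒≤ i≤j))) (⊩-keep (go i≤j))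

    true-theorem : (∀ {i} → T ∣ [] ⊢ subst (at i σ) φ) → True φ σ
    true-theorem d = truth (0 , λ _ → ⊩-theorem d)

    true-map : ∀ {m} {ψ : Formula L m} {τ : Env m} →
               (∀ {i Γ} → T ∣ Γ ⊢ subst (at i σ) φ → T ∣ Γ ⊢ subst (at i τ) ψ) →
               True φ σ → True ψ τ
    true-map f (truth (J , p)) = truth (J , λ J≤i → ⊩-map f (p J≤i))

    true-map₂ : ∀ {m k} {ψ : Formula L m} {τ : Env m} {χ : Formula L k} {υ : Env k} →
                (∀ {i Γ} → T ∣ Γ ⊢ subst (at i σ) φ → T ∣ Γ ⊢ subst (at i τ) ψ →
                           T ∣ Γ ⊢ subst (at i υ) χ) →
                True φ σ → True ψ τ → True χ υ
    true-map₂ f (truth (J , p)) (truth (K , q)) = truth (J ⊔ K , λ J⊔K≤i →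
      ⊩-map₂ f (p (≤-trans (m≤m⊔n J K) J⊔K≤i)) (q (≤-trans (m≤n⊔m J K) J⊔K≤i)))

  true-absurd : {σ : Env n} → True ⊥′ σ → R
  true-absurd (truth (J , p)) = stage-consistent J (p ≤-refl)

  absurd-true : {σ : Env n} → R → True ⊥′ σ
  absurd-true r = truth (0 , λ {i} _ → inconsistent i)
    where
    inconsistent : ∀ i → Stage i ⊩ ⊥′
    inconsistent zero    = ⊩-map (λ d → ⇒-E d (⊢-weaken (λ ()) (⊢-wk r))) (⊩-return refute)
    inconsistent (suc i) = ⊩-keep (inconsistent i)

  -- At a late stage `i` the implication is itself the conjecture, and it remains to justify
  -- `decide`. If `Δ` refutes it, then `Δ` proves `φ` and `¬′ ψ`; so `φ` is true, by `f` also `ψ`,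
  -- and truth of `ψ` and `¬′ ψ` gives an element of `R`. Since `¬′ φ₀` is present from the start,
  -- that makes stage `i` inconsistent, as required.
  true-⇒ : {φ ψ : Formula L n} {σ : Env n} → (True φ σ → True ψ σ) → True (φ ⇒ ψ) σ
  true-⇒ {φ = φ} {ψ} {σ} f with enumerate-cofinal (encode (φ ⇒ ψ) σ) (boundᴱ σ)
  ... | i , b , e = true-from (≤-trans b (n≤1+n i)) (⊩-return
          (≡.subst (Stage (suc i)) (trans (cong wk decoded) (wk-at (φ ⇒ ψ) σ b)) (decide dec)))
    where
    decoded : conjecture i ≡ subst (at i σ) (φ ⇒ ψ)
    decoded = trans (cong (λ t → decode t (stageVar i)) e) (decode-encode (φ ⇒ ψ) σ (stageVar i))
    refutation : ∀ {Δ} → T ∣ conjecture i ∷ Δ ⊢ ⊥′ → T ∣ Δ ⊢ ¬′ subst (at i σ) (φ ⇒ ψ)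
    refutation d = ⇒-I (≡.subst (λ χ → T ∣ χ ∷ _ ⊢ ⊥′) decoded d)
    premise : ∀ {Γ} {φ ψ : Formula L (suc i)} → T ∣ Γ ⊢ ¬′ (φ ⇒ ψ) → T ∣ Γ ⊢ φ
    premise d = raa (⇒-E (⊢-weaken there d) (⇒-I (raa (⇒-E (hyp (there (there (here refl)))) (hyp (there (here refl)))))))
    conclusion : ∀ {Γ} {φ ψ : Formula L (suc i)} → T ∣ Γ ⊢ ¬′ (φ ⇒ ψ) → T ∣ Γ ⊢ ¬′ ψ
    conclusion d = ⇒-I (⇒-E (⊢-weaken there d) (⇒-I (hyp (there (here refl)))))
    dec : ∀ {Δ} → All (Stage i) Δ → T ∣ conjecture i ∷ Δ ⊢ ⊥′ → Stage i ⊩ ⊥′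
    dec q d = proj₂ (eventually (absurd-true {σ = σ} (true-absurd (true-map₂ {χ = ⊥′} {υ = σ} ⇒-E
        (true-from {φ = ¬′ ψ} {σ} b (_ , q , conclusion (refutation d)))
        (f (true-from b (_ , q , premise (refutation d)))))))) z≤n

  -- At a late stage `i` the matrix is `φ`, and `witness` makes `∀′ φ` follow from the single
  -- instance at the fresh name `suc i`.
  true-∀ : {φ : Formula L (suc n)} {σ : Env n} → (∀ d → True φ (d ◂ σ)) → True (∀′ φ) σ
  true-∀ {φ = φ} {σ} f with enumerate-cofinal (encode φ (under σ)) (boundᴱ σ)
  ... | i , b , e = true-map (⊢-cast (subst-rename _ suc (∀′ φ)))
          (true-map₂ {φ = φ ⇒ wk (∀′ φ)} {σ = name (suc i) ◂ σ} {χ = wk (∀′ φ)} {υ = name (suc i) ◂ σ} ⇒-E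
            (true-from (⊔-lub ≤-refl (≤-trans b (n≤1+n i)))
              (⊩-return (≡.subst (Stage (suc i)) (cong₂ _⇒_ body closure) witness)))
            (f (name (suc i))))
    where
    decoded : matrix i ≡ subst (liftˢ (at i σ)) φ
    decoded = trans (cong (λ t → decode t (underᴺ (stageVar i))) e)
      (trans (decode-encode φ (under σ) (underᴺ (stageVar i))) (subst-cong (place-under (stageVar i) σ) φ))
    new : ∀ x → liftˢ (at i σ) x ≡ at (suc i) (name (suc i) ◂ σ) x
    new zero    = cong var (sym (stageVar-new i))
    new (suc x) = at-keep σ b x
    body : matrix i ≡ subst (at (suc i) (name (suc i) ◂ σ)) φ
    body = trans decoded (subst-cong new φ)
    closure : wk (∀′ matrix i) ≡ subst (at (suc i) (name (suc i) ◂ σ)) (wk (∀′ φ))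
    closure = trans (cong (λ χ → wk (∀′ χ)) decoded)
      (trans (wk-at (∀′ φ) σ b) (sym (subst-rename _ suc (∀′ φ))))

  true-¬ : {φ : Formula L n} {σ : Env n} → (True φ σ → R) → True (¬′ φ) σ
  true-¬ {σ = σ} f = true-⇒ (absurd-true {σ = σ} ∘ f)

  true-⇒-E : {φ ψ : Formula L n} {σ : Env n} → True (φ ⇒ ψ) σ → True φ σ → True ψ σ
  true-⇒-E = true-map₂ ⇒-E

  true-¬-E : {φ : Formula L n} {σ : Env n} → True (¬′ φ) σ → True φ σ → R
  true-¬-E {σ = σ} p q = true-absurd {σ = σ} (true-⇒-E p q)

  true-stable : {φ : Formula L n} {σ : Env n} → Stable (True φ σ)
  true-stable {φ = φ} .stable m = true-map (λ d → raa (⇒-E (⊢-weaken there d) (hyp (here refl))))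
    (true-¬ {φ = ¬′ φ} λ p → run m (true-¬-E p))

  instantiate : ∀ (φ : Formula L (suc n)) (σ : Env n) d i →
    subst (liftˢ (at i σ)) φ [ place (stageVar i) d ] ≡ subst (at i (d ◂ σ)) φ
  instantiate φ σ d i = subst-∘
    (λ { zero → refl ; (suc x) → trans (substᵗ-renameᵗ _ suc (at i σ x)) (substᵗ-id (λ _ → refl) _) }) φ

  true-∀-E : {φ : Formula L (suc n)} {σ : Env n} → True (∀′ φ) σ → ∀ d → True φ (d ◂ σ)
  true-∀-E {φ = φ} {σ} p d = true-map (λ {i} e → ⊢-cast (instantiate φ σ d i) (∀-E e (place (stageVar i) d))) p

  termModel : Interpretation L R
  termModel = named
    (λ r ds → Eventually λ i → rel r (places (stageVar i) ds))
    (λ d e → Eventually λ i → (place (stageVar i) d ≐ place (stageVar i) e))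
  open Interpretation termModel

  eventually-cast : {χ ω : ∀ i → Formula L (suc i)} → (∀ i → χ i ≡ ω i) → Eventually χ → Eventually ω
  eventually-cast e (J , p) = J , λ {i} J≤i → ≡.subst (Stage i ⊩_) (e i) (p J≤i)

  mutual
    -- The truth lemma; implication forces the two directions to be mutual. No disjunct or witness
    -- ever has to be found: in this direction `true-stable` removes the double negation, in the
    -- other it is the goal.
    ⟦⟧⇒true : ∀ φ {σ : Env n} → ⟦ φ ⟧ σ → True φ σ
    ⟦⟧⇒true (rel r ts) {σ} p =
      truth (eventually-cast (λ i → cong (rel r) (places-evals (stageVar i) ts σ)) p)
    ⟦⟧⇒true (s ≐ t) {σ} p =
      truth (eventually-cast (λ i → cong₂ _≐_ (place-eval (stageVar i) s σ) (place-eval (stageVar i) t σ)) p)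
    ⟦⟧⇒true ⊥′      p = absurd-true p
    ⟦⟧⇒true (φ ⇒ ψ) p = true-⇒ (⟦⟧⇒true ψ ∘ p ∘ true⇒⟦⟧ φ)
    ⟦⟧⇒true (φ ∧ ψ) (p , q) = true-map₂ ∧-I (⟦⟧⇒true φ p) (⟦⟧⇒true ψ q)
    ⟦⟧⇒true (φ ∨ ψ) p = _>>=_ {{true-stable}} p λ where
      (inj₁ q) → true-map ∨-I₁ (⟦⟧⇒true φ q)
      (inj₂ q) → true-map ∨-I₂ (⟦⟧⇒true ψ q)
    ⟦⟧⇒true (∀′ φ) p = true-∀ λ d → ⟦⟧⇒true φ (p d)
    ⟦⟧⇒true (∃′ φ) {σ} p = _>>=_ {{true-stable}} p λ (d , q) →
      true-map (λ {i} e → ∃-I (place (stageVar i) d) (⊢-cast (sym (instantiate φ σ d i)) e)) (⟦⟧⇒true φ q)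

    true⇒⟦⟧ : ∀ φ {σ : Env n} → True φ σ → ⟦ φ ⟧ σ
    true⇒⟦⟧ (rel r ts) {σ} (truth p) =
      eventually-cast (λ i → sym (cong (rel r) (places-evals (stageVar i) ts σ))) p
    true⇒⟦⟧ (s ≐ t) {σ} (truth p) =
      eventually-cast (λ i → sym (cong₂ _≐_ (place-eval (stageVar i) s σ) (place-eval (stageVar i) t σ))) p
    true⇒⟦⟧ ⊥′      p = true-absurd p
    true⇒⟦⟧ (φ ⇒ ψ) p = true⇒⟦⟧ ψ ∘ true-⇒-E p ∘ ⟦⟧⇒true φ
    true⇒⟦⟧ (φ ∧ ψ) p = true⇒⟦⟧ φ (true-map ∧-E₁ p) , true⇒⟦⟧ ψ (true-map ∧-E₂ p)
    true⇒⟦⟧ (φ ∨ ψ) {σ} p = cont λ k →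
      true-absurd (true-map₂ {υ = σ} (λ d e → ∨-E d
          (⇒-E (∧-E₁ (⊢-weaken there e)) (hyp (here refl)))
          (⇒-E (∧-E₂ (⊢-weaken there e)) (hyp (here refl)))) p
        (true-map₂ {χ = ¬′ φ ∧ ¬′ ψ} {υ = σ} ∧-I
          (true-¬ (k ∘ inj₁ ∘ true⇒⟦⟧ φ)) (true-¬ (k ∘ inj₂ ∘ true⇒⟦⟧ ψ))))
    true⇒⟦⟧ (∀′ φ) p d = true⇒⟦⟧ φ (true-∀-E p d)
    true⇒⟦⟧ (∃′ φ) {σ} p = cont λ k →
      true-absurd (true-map₂ {υ = σ} (λ {i} d e → ∃-E d
          (⇒-E (⊢-cast (lift-suc-[v0] (¬′ subst (liftˢ (at i σ)) φ)) (∀-E (⊢-weaken there (⊢-wk e)) v0))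
               (hyp (here refl)))) p
        (true-∀ {φ = ¬′ φ} λ d → true-¬ λ q → k (d , true⇒⟦⟧ φ q)))

  termModel-⊨ : Model T R
  termModel-⊨ = record
    { interpretation = termModel
    ; ⟦⟧-stable = λ φ σ → record { stable = λ m → true⇒⟦⟧ φ (_>>=_ {{true-stable}} m (⟦⟧⇒true φ)) }
    ; ≐-refl    = λ d → 0 , λ {i} _ → ⊩-theorem (≐-I _)
    ; ≐-subst   = λ φ σ {d} {e} d≐e p → true⇒⟦⟧ φ (true-map₂ {φ = v0 ≐ v1} {σ = d ◂ e ◂ none}
        (λ {i} eq q → ⊢-cast (instantiate φ σ e i)
          (≐-E _ eq (⊢-cast (sym (instantiate φ σ d i)) q)))
        (truth d≐e) (⟦⟧⇒true φ p))
    ; sound     = λ {φ} t σ → true⇒⟦⟧ φ (true-theorem (⊢-cast (closed φ σ _) (axiom t)))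
    }
    where
    closed : ∀ φ (σ : Env 0) i → rename (λ ()) φ ≡ subst (at i σ) φ
    closed φ σ i = rename≡subst (λ ()) φ

-- Validity is applied to the term model whose falsum is `T ⊢ φ`. There `¬′ φ` is true by
-- construction, so truth of `φ` gives falsum, which is the derivation sought.
completeness : {L : Language} (C : Countable L) {T : Theory L} {φ : Sentence L} →
               (∀ {R} (M : Model T R) → ∀ σ → Model.⟦_⟧ M φ σ) → T ⊢ φ
completeness C {T} {φ} valid = true-¬-E
  (true-from z≤n (⊩-return (≡.subst Initial (rename≡subst (λ ()) (¬′ φ)) refute)))
  (⟦⟧⇒true φ (valid termModel-⊨ none))
  where open Completeness C T φ

-- Names

module _ where
  open SO-axioms

  ↑² : Fin n → Fin (suc (suc n))
  ↑² i = suc (suc i)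

  ↑³ : Fin n → Fin (suc (suc (suc n)))
  ↑³ i = suc (suc (suc i))

  -- These formulas are laid out so that their interpretations unfold by computation to `Edge`,
  -- `Root`, `Sim` and so on, apart from the record `Ext`. Induction and separation then apply to
  -- them without conversion.
  edgeᶠ : (x β γ : Fin n) → Formula L-SO n
  edgeᶠ x β γ = (var β < var γ) ∧ (G (var β) (var γ) ∈′ var x)

  rootᶠ : (x β : Fin n) → Formula L-SO n
  rootᶠ x β = Ord (var β) ∧ (G (var β) (var β) ∈′ var x)

  bisimulationᶠ : (x y r : Fin n) → Formula L-SO n
  bisimulationᶠ x y r = ∀′ ∀′ Ord v1 ⇒ Ord v0 ⇒ G v1 v0 ∈′ var (↑² r) ⇒
    (∀′ edgeᶠ (↑³ x) zero (↑² zero) ⇒ (∃′ edgeᶠ (↑³ (suc y)) zero (↑² zero) ∧ G v1 v0 ∈′ var (↑³ (suc r)))) ∧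
    (∀′ edgeᶠ (↑³ y) zero (suc zero) ⇒ (∃′ edgeᶠ (↑³ (suc x)) zero (↑³ zero) ∧ G v0 v1 ∈′ var (↑³ (suc r))))

  simᶠ : (x β y γ : Fin n) → Formula L-SO n
  simᶠ x β y γ = ∃′ (Ord (var (suc β)) ∧ Ord (var (suc γ)) ∧ G (var (suc β)) (var (suc γ)) ∈′ v0) ∧
    bisimulationᶠ (suc x) (suc y) zero

  denᶠ : (z x β : Fin n) → Formula L-SO n
  denᶠ z x β = (∀′ rootᶠ (suc z) zero ⇒
                  (∃′ edgeᶠ (↑² x) zero (↑² β) ∧ simᶠ (↑² z) (suc zero) (↑² x) zero))
             ∧ (∀′ edgeᶠ (suc x) zero (suc β) ⇒
                  (∃′ rootᶠ (↑² z) zero ∧ simᶠ (↑² z) zero (↑² x) (suc zero)))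

  ≈ᶠ : (x y : Fin n) → Formula L-SO n
  ≈ᶠ x y = (∀′ rootᶠ (suc x) zero ⇒ (∃′ rootᶠ (↑² y) zero ∧ simᶠ (↑² x) (suc zero) (↑² y) zero))
         ∧ (∀′ rootᶠ (suc y) zero ⇒ (∃′ rootᶠ (↑² x) zero ∧ simᶠ (↑² x) zero (↑² y) (suc zero)))

  εᶠ : (z x : Fin n) → Formula L-SO n
  εᶠ z x = ∃′ rootᶠ (suc x) zero ∧ denᶠ (suc z) (suc x) zero

  candidateᶠ : (x β γ : Fin n) → Formula L-SO n
  candidateᶠ x β γ = ∃′ edgeᶠ (suc x) zero (suc β) ∧ simᶠ (suc x) (suc γ) (suc x) zero

SO-countable : Countable L-SO
SO-countable = record
  { relation  = λ { leaf → 1 , Ordˢ ; (node leaf _) → 1 , SOrdˢ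
                  ; (node (node _ _) leaf) → 2 , <ˢ ; (node (node _ _) (node _ _)) → 2 , ∈ˢ }
  ; relation⁻ = λ { Ordˢ → leaf , refl ; SOrdˢ → node leaf leaf , refl
                  ; <ˢ → node (node leaf leaf) leaf , refl
                  ; ∈ˢ → node (node leaf leaf) (node leaf leaf) , refl }
  ; function  = λ _ → 2 , Gˢ
  ; function⁻ = λ { Gˢ → leaf , refl }
  }

-- The domain can be everything because an ordinal has no elements, hence no roots, and so names the
-- empty set.
sets : Structure L-SO L-∈
sets = record
  { Uᴬ   = ⊥′ ⇒ ⊥′
  ; ≈ᴬ   = ≈ᶠ zero (suc zero)
  ; relᴬ = λ { ∈ˢ → εᶠ zero (suc zero) }
  ; funᴬ = λ ()
  }

-- Ordinals and codes of pairs in a model of `SO`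

module Universe {R : Set} (M : Model SO R) where
  open SO-axioms
  open Model M
  open Continuation R

  private variable
    P Q S : D → Set
    α β γ δ x x′ y z z′ : D

  infix 4 _≺_ _≼_ _∋_ _≗_

  IsOrd IsSOrd : D → Set
  IsOrd x  = relI Ordˢ (x ∷ [])
  IsSOrd x = relI SOrdˢ (x ∷ [])

  _≺_ _≗_ _∋_ _≼_ : D → D → Set
  x ≺ y = relI <ˢ (x ∷ y ∷ [])
  a ∋ x = relI ∈ˢ (x ∷ a ∷ [])
  x ≗ y = eqI x y
  x ≼ y = ⟪ x ≺ y ⊎ x ≗ y ⟫

  g : D → D → D
  g x y = funI Gˢ (x ∷ y ∷ [])

  ∅ : Fin 0 → D
  ∅ ()

  instance
    stable-IsOrd : Stable (IsOrd x)
    stable-IsOrd {x} = ⟦⟧-stable (Ord v0) (x ◂ ∅)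
    stable-IsSOrd : Stable (IsSOrd x)
    stable-IsSOrd {x} = ⟦⟧-stable (SOrd v0) (x ◂ ∅)
    stable-≺ : Stable (x ≺ y)
    stable-≺ {x} {y} = ⟦⟧-stable (v0 < v1) (x ◂ y ◂ ∅)
    stable-∋ : Stable (y ∋ x)
    stable-∋ {y} {x} = ⟦⟧-stable (v0 ∈′ v1) (x ◂ y ◂ ∅)
    stable-≗ : Stable (x ≗ y)
    stable-≗ {x} {y} = ⟦⟧-stable (v0 ≐ v1) (x ◂ y ◂ ∅)

  ≗-refl : x ≗ x
  ≗-refl = ≐-refl _

  ≗-sym : x ≗ y → y ≗ x
  ≗-sym {x} e = ≐-subst (v0 ≐ v1) (x ◂ ∅) e ≗-refl

  ≗-trans : x ≗ y → y ≗ z → x ≗ z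
  ≗-trans {x} e f = ≐-subst (v1 ≐ v0) (x ◂ ∅) f e

  ≺-respˡ : x ≗ y → x ≺ z → y ≺ z
  ≺-respˡ {z = z} e = ≐-subst (v0 < v1) (z ◂ ∅) e

  ≺-respʳ : x ≗ y → z ≺ x → z ≺ y
  ≺-respʳ {z = z} e = ≐-subst (v1 < v0) (z ◂ ∅) e

  ∋-resp : ∀ {a} → x ≗ y → a ∋ x → a ∋ y
  ∋-resp {a = a} e = ≐-subst (v0 ∈′ v1) (a ◂ ∅) e

  g-cong : ∀ {x x′ y y′} → x ≗ x′ → y ≗ y′ → g x y ≗ g x′ y′
  g-cong {x} {x′} {y} e f =
    ≐-subst (G v1 v2 ≐ G v3 v0) (x ◂ y ◂ x′ ◂ ∅) f (≐-subst (G v1 v2 ≐ G v0 v2) (x ◂ y ◂ ∅) e ≗-refl)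

  ⟨sor⟩ : ∀ x y → (IsOrd x ↔ (IsSOrd x → R)) × (x ≺ y → IsOrd x × IsOrd y)
    × (y ∋ x → IsOrd x × IsSOrd y) × IsOrd (g x y)
  ⟨sor⟩ = sound sor ∅

  ≺-ordˡ : x ≺ y → IsOrd x
  ≺-ordˡ {x} {y} p = proj₁ (proj₁ (proj₂ (⟨sor⟩ x y)) p)

  ≺-ordʳ : x ≺ y → IsOrd y
  ≺-ordʳ {x} {y} p = proj₂ (proj₁ (proj₂ (⟨sor⟩ x y)) p)

  ∋-ord : y ∋ x → IsOrd x
  ∋-ord {y} {x} p = proj₁ (proj₁ (proj₂ (proj₂ (⟨sor⟩ x y))) p)

  ∋-sord : y ∋ x → IsSOrd y
  ∋-sord {y} {x} p = proj₂ (proj₁ (proj₂ (proj₂ (⟨sor⟩ x y))) p)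

  g-ord : IsOrd (g x y)
  g-ord {x} {y} = proj₂ (proj₂ (proj₂ (⟨sor⟩ x y)))

  ≺-irrefl : x ≺ x → R
  ≺-irrefl p = proj₁ (proj₁ (sound wo ∅ _ (≺-ordˡ p) _ (≺-ordˡ p) _ (≺-ordˡ p))) p

  ≺-trans : x ≺ y → y ≺ z → x ≺ z
  ≺-trans p q = proj₁ (proj₂ (proj₁ (sound wo ∅ _ (≺-ordˡ p) _ (≺-ordˡ q) _ (≺-ordʳ q)))) (p , q)

  ≺-tri : IsOrd x → IsOrd y → ⟪ x ≺ y ⊎ x ≗ y ⊎ y ≺ x ⟫
  ≺-tri o o′ = proj₂ (proj₂ (proj₁ (sound wo ∅ _ o _ o′ _ o))) >>= λ where
    (inj₁ p) → return (inj₁ p)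
    (inj₂ p) → p >>= λ where
      (inj₁ q) → return (inj₂ (inj₁ q))
      (inj₂ q) → return (inj₂ (inj₂ q))

  ≼-≺-trans : x ≼ y → y ≺ z → x ≺ z
  ≼-≺-trans p q = p >>= λ where
    (inj₁ p) → ≺-trans p q
    (inj₂ e) → ≺-respˡ (≗-sym e) q

  ≺-≼-trans : x ≺ y → y ≼ z → x ≺ z
  ≺-≼-trans p q = q >>= λ where
    (inj₁ q) → ≺-trans p q
    (inj₂ e) → ≺-respʳ e p

  ≺⇒≼ : x ≺ y → x ≼ y
  ≺⇒≼ p = return (inj₁ p)

  ⊀⇒≽ : IsOrd x → IsOrd y → (x ≺ y → R) → y ≼ x
  ⊀⇒≽ o o′ np = ≺-tri o o′ >>= λ where
    (inj₁ p)        → explode (np p)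
    (inj₂ (inj₁ e)) → return (inj₂ (≗-sym e))
    (inj₂ (inj₂ p)) → ≺⇒≼ p

  ⟨sep⟩ : (φ : Formula L-SO (suc n)) (σ : Fin n → D) → ∀ a → IsSOrd a →
          ⟪ Σ[ b ∈ D ] IsSOrd b × (∀ x → IsOrd x → b ∋ x ↔ (a ∋ x × ⟦ φ ⟧ (x ◂ σ))) ⟫
  ⟨sep⟩ {n} φ σ a sa = ⟦∀*⟧→ n _ (sound (sep φ) ∅) σ a sa >>= λ (b , sb , h) →
    return (b , sb , λ x ox → let (f , f⁻) = h x ox ; (s , s⁻) = conv b x in
      (λ p → proj₁ (f p) , s (proj₂ (f p))) , λ (p , q) → f⁻ (p , s⁻ q))
    where
    conv : ∀ b x → ⟦ subst (v0 ◂ params 3) φ ⟧ (x ◂ b ◂ a ◂ σ) ↔ ⟦ φ ⟧ (x ◂ σ)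
    conv b x = ⟦subst⟧ (λ { zero → refl ; (suc _) → refl }) φ

  ⟨rep⟩ : (φ : Formula L-SO (suc (suc n))) (σ : Fin n → D) →
          (∀ x → IsOrd x → ∀ y → IsOrd y → ∀ y′ → IsOrd y′ →
            ⟦ φ ⟧ (x ◂ y ◂ σ) → ⟦ φ ⟧ (x ◂ y′ ◂ σ) → y ≗ y′) →
          ∀ a → IsSOrd a →
          ⟪ Σ[ b ∈ D ] IsSOrd b × (∀ x y → a ∋ x → IsOrd y → ⟦ φ ⟧ (x ◂ y ◂ σ) → b ∋ y) ⟫
  ⟨rep⟩ {n} φ σ functional a sa =
    ⟦∀*⟧→ n _ (sound (rep φ) ∅) σ functional′ a sa >>= λ (b , sb , h) →
      return (b , sb , λ x y p oy q → proj₂ (h y oy)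
        (return (x , ∋-ord p , p , proj₂ (⟦subst⟧ (λ { zero → refl ; (suc zero) → refl ; (suc (suc _)) → refl }) φ) q)))
    where
    functional′ : ∀ x → IsOrd x → ∀ y → IsOrd y → ∀ y′ → IsOrd y′ →
      ⟦ subst (v2 ◂ v1 ◂ params 3) φ ⟧ (y′ ◂ y ◂ x ◂ σ) × ⟦ subst (v2 ◂ v0 ◂ params 3) φ ⟧ (y′ ◂ y ◂ x ◂ σ) →
      y ≗ y′
    functional′ x ox y oy y′ oy′ (p , q) = functional x ox y oy y′ oy′
      (proj₁ (⟦subst⟧ (λ { zero → refl ; (suc zero) → refl ; (suc (suc _)) → refl }) φ) p)
      (proj₁ (⟦subst⟧ (λ { zero → refl ; (suc zero) → refl ; (suc (suc _)) → refl }) φ) q)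

  -- WO provides minima of sets only, so `φ` is first cut out of the initial segment below `α`; if
  -- nothing is found there, `α` itself is least.
  least : (φ : Formula L-SO (suc n)) (σ : Fin n → D) → IsOrd α → ⟦ φ ⟧ (α ◂ σ) →
          ⟪ Σ[ β ∈ D ] IsOrd β × ⟦ φ ⟧ (β ◂ σ) × (∀ γ → γ ≺ β → ⟦ φ ⟧ (γ ◂ σ) → R) ⟫
  least {α = α} φ σ oα p =
    sound ini ∅ α oα >>= λ (a , sa , h) →
    ⟨sep⟩ φ σ a sa >>= λ (b , sb , k) →
    lem ⟪ Σ[ β ∈ D ] IsOrd β × b ∋ β ⟫ >>= λ where
      (inj₁ q) → proj₂ (sound wo ∅ α oα α oα α oα) b sb q >>= λ (β , oβ , b∋β , min) →
        return (β , oβ , proj₂ (proj₁ (k β oβ) b∋β) , λ γ γ≺β r → min γ (≺-ordˡ γ≺β) γ≺β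
          (proj₂ (k γ (≺-ordˡ γ≺β)) (proj₁ (h γ (≺-ordˡ γ≺β))
            (≺-trans γ≺β (proj₂ (h β oβ) (proj₁ (proj₁ (k β oβ) b∋β)))) , r)))
      (inj₂ n) → return (α , oα , p , λ γ γ≺α r → n (return (γ , ≺-ordˡ γ≺α ,
          proj₂ (k γ (≺-ordˡ γ≺α)) (proj₁ (h γ (≺-ordˡ γ≺α)) γ≺α , r))))

  induction : (φ : Formula L-SO (suc n)) (σ : Fin n → D) →
              (∀ α → IsOrd α → (∀ β → β ≺ α → ⟦ φ ⟧ (β ◂ σ)) → ⟦ φ ⟧ (α ◂ σ)) →
              ∀ α → IsOrd α → ⟦ φ ⟧ (α ◂ σ)
  induction φ σ step α oα = by-contra {{⟦⟧-stable φ _}} λ np →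
    least (¬′ φ) σ oα np >>= λ (β , oβ , nq , min) →
      nq (step β oβ λ γ γ≺β → by-contra {{⟦⟧-stable φ _}} (min γ γ≺β))

  Max : D → D → D → Set
  Max μ α β = ⟪ μ ≗ α ⊎ μ ≗ β ⟫ × α ≼ μ × β ≼ μ

  Pair< : D → D → D → D → Set
  Pair< α β γ δ = ⟪ Σ[ μ ∈ D ] IsOrd μ × ⟪ Σ[ ν ∈ D ] IsOrd ν × Max μ α β × Max ν γ δ ×
    ⟪ μ ≺ ν ⊎ ⟪ μ ≗ ν × α ≺ γ ⊎ μ ≗ ν × α ≗ γ × β ≺ δ ⟫ ⟫ ⟫ ⟫

  -- This is GPF with `g γ δ` as the upper bound, where its left side holds by reflexivity.
  g-mono : IsOrd α → IsOrd β → IsOrd γ → IsOrd δ → Pair< α β γ δ → g α β ≺ g γ δ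
  g-mono {α} {β} {γ} {δ} oα oβ oγ oδ p =
    proj₁ (sound gpf ∅ (g γ δ) g-ord γ oγ δ oδ) (return (inj₂ ≗-refl)) α oα β oβ p

  max-exists : IsOrd α → IsOrd β → ⟪ Σ[ μ ∈ D ] IsOrd μ × Max μ α β ⟫
  max-exists {α} {β} oα oβ = ≺-tri oα oβ >>= λ where
    (inj₁ p)        → return (β , oβ , return (inj₂ ≗-refl) , ≺⇒≼ p , return (inj₂ ≗-refl))
    (inj₂ (inj₁ e)) → return (β , oβ , return (inj₂ ≗-refl) , return (inj₂ e) , return (inj₂ ≗-refl))
    (inj₂ (inj₂ p)) → return (α , oα , return (inj₁ ≗-refl) , return (inj₂ ≗-refl) , ≺⇒≼ p)

  max-lub : ∀ {μ ν} → Max μ α β → α ≼ ν → β ≼ ν → μ ≼ ν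
  max-lub (m , _ , _) p q = m >>= λ where
    (inj₁ e) → p >>= λ where
      (inj₁ r) → return (inj₁ (≺-respˡ (≗-sym e) r))
      (inj₂ r) → return (inj₂ (≗-trans e r))
    (inj₂ e) → q >>= λ where
      (inj₁ r) → return (inj₁ (≺-respˡ (≗-sym e) r))
      (inj₂ r) → return (inj₂ (≗-trans e r))

  g-monoʳ : IsOrd α → β ≺ γ → g α β ≺ g α γ
  g-monoʳ oα p = max-exists oα (≺-ordˡ p) >>= λ (μ , oμ , m) → max-exists oα (≺-ordʳ p) >>= λ (ν , oν , m′) →
    g-mono oα (≺-ordˡ p) oα (≺-ordʳ p) (return (μ , oμ , return (ν , oν , m , m′ ,
      (max-lub m (proj₁ (proj₂ m′)) (≺⇒≼ (≺-≼-trans p (proj₂ (proj₂ m′)))) >>= λ where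
        (inj₁ q) → return (inj₁ q)
        (inj₂ e) → return (inj₂ (return (inj₂ (e , ≗-refl , p))))))))

  g-monoˡ : IsOrd γ → α ≺ β → g α γ ≺ g β γ
  g-monoˡ oγ p = max-exists (≺-ordˡ p) oγ >>= λ (μ , oμ , m) → max-exists (≺-ordʳ p) oγ >>= λ (ν , oν , m′) →
    g-mono (≺-ordˡ p) oγ (≺-ordʳ p) oγ (return (μ , oμ , return (ν , oν , m , m′ ,
      (max-lub m (≺⇒≼ (≺-≼-trans p (proj₁ (proj₂ m′)))) (proj₂ (proj₂ m′)) >>= λ where
        (inj₁ q) → return (inj₁ q)
        (inj₂ e) → return (inj₂ (return (inj₁ (e , p))))))))

  g-mono₂ : α ≺ β → γ ≺ δ → g α γ ≺ g β δ
  g-mono₂ p q = ≺-trans (g-monoˡ (≺-ordˡ q) p) (g-monoʳ (≺-ordʳ p) q)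

  -- The order of pairs is linear, so of two different pairs one is smaller, and `g-mono` separates
  -- their codes.
  g-injective : IsOrd α → IsOrd β → IsOrd γ → IsOrd δ → g α β ≗ g γ δ → α ≗ γ × β ≗ δ
  g-injective oα oβ oγ oδ e =
    max-exists oα oβ >>= λ (μ , oμ , m) → max-exists oγ oδ >>= λ (ν , oν , m′) →
    ≺-tri oμ oν >>= λ where
      (inj₁ p) → explode (below (return (μ , oμ , return (ν , oν , m , m′ , return (inj₁ p)))))
      (inj₂ (inj₂ p)) → explode (above (return (ν , oν , return (μ , oμ , m′ , m , return (inj₁ p)))))
      (inj₂ (inj₁ μν)) → ≺-tri oα oγ >>= λ where
        (inj₁ p) → explode (below (return (μ , oμ , return (ν , oν , m , m′ ,
          return (inj₂ (return (inj₁ (μν , p))))))))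
        (inj₂ (inj₂ p)) → explode (above (return (ν , oν , return (μ , oμ , m′ , m ,
          return (inj₂ (return (inj₁ (≗-sym μν , p))))))))
        (inj₂ (inj₁ αγ)) → ≺-tri oβ oδ >>= λ where
          (inj₁ p) → explode (below (return (μ , oμ , return (ν , oν , m , m′ ,
            return (inj₂ (return (inj₂ (μν , αγ , p))))))))
          (inj₂ (inj₂ p)) → explode (above (return (ν , oν , return (μ , oμ , m′ , m ,
            return (inj₂ (return (inj₂ (≗-sym μν , ≗-sym αγ , p))))))))
          (inj₂ (inj₁ βδ)) → αγ , βδ
    where
    below : Pair< _ _ _ _ → R
    below p = ≺-irrefl (≺-respˡ e (g-mono oα oβ oγ oδ p))
    above : Pair< _ _ _ _ → R
    above p = ≺-irrefl (≺-respʳ e (g-mono oγ oδ oα oβ p))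

  -- A strictly increasing map never falls below its argument: for the least `ξ` with `g ξ β ≺ ξ`,
  -- monotonicity makes `g ξ β` a smaller counterexample.
  ≼-gˡ : IsOrd α → IsOrd β → α ≼ g α β
  ≼-gˡ {α} {β} oα oβ = ⊀⇒≽ g-ord oα λ p →
    least (G v0 v1 < v0) (β ◂ ∅) oα p >>= λ (ξ , oξ , q , min) → min (g ξ β) q (g-monoˡ oβ q)

  ≼-gʳ : IsOrd α → IsOrd β → β ≼ g α β
  ≼-gʳ {α} {β} oα oβ = ⊀⇒≽ g-ord oβ λ p →
    least (G v1 v0 < v0) (α ◂ ∅) oβ p >>= λ (ξ , oξ , q , min) → min (g α ξ) q (g-monoʳ oα q)

  larger : IsOrd α → ⟪ Σ[ β ∈ D ] α ≺ β ⟫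
  larger {α} oα = sound inf ∅ >>= λ (ω , oω , positive , _) → positive >>= λ (o , oo , o≺ω) →
    return (g ω α , ≼-≺-trans (≼-gʳ oo oα) (g-monoˡ oα o≺ω))

  larger₂ : IsOrd α → IsOrd β → ⟪ Σ[ γ ∈ D ] α ≺ γ × β ≺ γ ⟫
  larger₂ oα oβ = larger (g-ord {_} {_}) >>= λ (γ , p) →
    return (γ , ≼-≺-trans (≼-gˡ oα oβ) p , ≼-≺-trans (≼-gʳ oα oβ) p)

  bounded : ∀ a → ⟪ Σ[ δ ∈ D ] IsOrd δ × (∀ x → a ∋ x → x ≺ δ) ⟫
  bounded a = lem (IsSOrd a) >>= λ where
    (inj₁ sa) → sound bou ∅ a sa >>= λ (δ , oδ , h) → return (δ , oδ , λ x p → h x (∋-ord p) p)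
    -- An object that is not a set of ordinals has no elements, so any ordinal bounds them.
    (inj₂ na) → sound inf ∅ >>= λ (ω , oω , _) → return (ω , oω , λ x p → explode (na (∋-sord p)))

  initial : IsOrd α → ⟪ Σ[ a ∈ D ] IsSOrd a × (∀ x → IsOrd x → x ≺ α ↔ a ∋ x) ⟫
  initial oα = sound ini ∅ _ oα

  -- The subset that POW leaves out, the empty one, is the section at any ordinal bounding b.
  powerset : IsOrd α → ⟪ Σ[ b ∈ D ] Σ[ θ ∈ D ] IsOrd θ × (∀ x → b ∋ x → x ≺ θ) ×
    (∀ z → (∀ x → z ∋ x → x ≺ α) →
      ⟪ Σ[ ξ ∈ D ] ξ ≺ θ × (∀ x → IsOrd x → z ∋ x ↔ b ∋ g x ξ) ⟫) ⟫
  powerset {α} oα = initial oα >>= λ (a , sa , h) → sound pow ∅ a sa >>= λ (b , sb , k) →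
    -- `θ` is taken above the bound `θ₀` to make `θ₀` itself an admissible index.
    bounded b >>= λ (θ₀ , oθ₀ , bθ₀) → larger oθ₀ >>= λ (θ , θ₀≺θ) →
    return (b , θ , ≺-ordʳ θ₀≺θ , (λ x p → ≺-trans (bθ₀ x p) θ₀≺θ) , λ z z⊆α →
      lem ⟪ Σ[ x ∈ D ] IsOrd x × z ∋ x ⟫ >>= λ where
        (inj₁ q) → q >>= λ (x , ox , z∋x) →
          k z (∋-sord z∋x) (q , λ y oy p → proj₁ (h y oy) (z⊆α y p)) >>= λ (ξ , oξ , e , _) →
            return (ξ , ≼-≺-trans (≼-gʳ ox oξ) (≺-trans (bθ₀ _ (proj₁ (e x ox) z∋x)) θ₀≺θ) , e)
        (inj₂ n) → return (θ₀ , θ₀≺θ , λ x ox →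
          (λ p → explode (n (return (x , ox , p)))) ,
          (λ p → explode (≺-irrefl (≼-≺-trans (≼-gʳ ox oθ₀) (bθ₀ _ p))))))

  resp₂ : (Φ : Formula L-SO (suc (suc n))) (σ : Fin n → D) → ∀ {x x′ y y′} → x ≗ x′ → y ≗ y′ →
          ⟦ Φ ⟧ (x ◂ y ◂ σ) → ⟦ Φ ⟧ (x′ ◂ y′ ◂ σ)
  resp₂ {n} Φ σ {x} {x′} {y} {y′} e f p =
    proj₁ (⟦rename⟧ (λ { zero → refl ; (suc zero) → refl ; (suc (suc _)) → refl }) Φ)
      (≐-subst (rename swap Φ) (x′ ◂ σ) f
        (proj₂ (⟦rename⟧ (λ { zero → refl ; (suc zero) → refl ; (suc (suc _)) → refl }) Φ)
          (≐-subst Φ (y ◂ σ) e p)))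
    where
    swap : Fin (suc (suc n)) → Fin (suc (suc n))
    swap = suc zero ◂ zero ◂ ↑²

  -- Comprehension for binary relations on `δ`: codes of pairs below `δ` lie below `g δ δ`, so
  -- separation from one initial segment suffices, and injectivity of `g` recovers the pair.
  graph : (Φ : Formula L-SO (suc (suc n))) (σ : Fin n → D) → IsOrd δ →
          ⟪ Σ[ a ∈ D ] (∀ {β γ} → IsOrd β → IsOrd γ →
            a ∋ g β γ ↔ (β ≺ δ × γ ≺ δ × ⟦ Φ ⟧ (β ◂ γ ◂ σ))) ⟫
  graph {n} {δ} Φ σ oδ = initial (g-ord {δ} {δ}) >>= λ (c , sc , h) →
    ⟨sep⟩ (∃′ ∃′ (v0 < v3) ∧ (v1 < v3) ∧ v2 ≐ G v0 v1 ∧ rename (lift 2 ↑²) Φ) (δ ◂ σ) c sc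
      >>= λ (a , _ , k) → return (a , λ {β} {γ} oβ oγ →
        (λ p → proj₂ (proj₁ (k _ g-ord) p) >>= λ (γ′ , q) → q >>= λ (β′ , β′δ , γ′δ , e , φ) →
          let (eβ , eγ) = g-injective oβ oγ (≺-ordˡ β′δ) (≺-ordˡ γ′δ) e in
          ≺-respˡ (≗-sym eβ) β′δ , ≺-respˡ (≗-sym eγ) γ′δ ,
          resp₂ Φ σ (≗-sym eβ) (≗-sym eγ) (proj₁ (⟦rename⟧ (agree {β′} {γ′} {g β γ}) Φ) φ)) ,
        λ (p , q , φ) → proj₂ (k _ g-ord) (proj₁ (h _ g-ord) (g-mono₂ p q) ,
          return (γ , return (β , p , q , ≗-refl , proj₂ (⟦rename⟧ (agree {β} {γ} {g β γ}) Φ) φ))))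
    where
    instance
      stable-Φ : ∀ {β γ} → Stable (⟦ Φ ⟧ (β ◂ γ ◂ σ))
      stable-Φ = ⟦⟧-stable Φ _
    agree : ∀ {β γ c} i → (β ◂ γ ◂ c ◂ δ ◂ σ) (lift 2 ↑² i) ≡ (β ◂ γ ◂ σ) i
    agree zero          = refl
    agree (suc zero)    = refl
    agree (suc (suc i)) = refl

  -- Bisimilarity and membership

  Edge : D → D → D → Set
  Edge x β γ = β ≺ γ × x ∋ g β γ

  Root : D → D → Set
  Root x β = IsOrd β × x ∋ g β β

  Bisimulation : D → D → D → Set
  Bisimulation x y r = ∀ β γ → IsOrd β → IsOrd γ → r ∋ g β γ →
    (∀ β′ → Edge x β′ β → ⟪ Σ[ γ′ ∈ D ] Edge y γ′ γ × r ∋ g β′ γ′ ⟫) ×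
    (∀ γ′ → Edge y γ′ γ → ⟪ Σ[ β′ ∈ D ] Edge x β′ β × r ∋ g β′ γ′ ⟫)

  Sim : D → D → D → D → Set
  Sim x β y γ = ⟪ Σ[ r ∈ D ] (IsOrd β × IsOrd γ × r ∋ g β γ) × Bisimulation x y r ⟫

  -- The sets denoted by the nodes P of x and by the nodes Q of y have the same elements.
  record Ext (P : D → Set) (x : D) (Q : D → Set) (y : D) : Set where
    constructor ext
    field
      forth : ∀ {β} → P β → ⟪ Σ[ γ ∈ D ] Q γ × Sim x β y γ ⟫
      back  : ∀ {γ} → Q γ → ⟪ Σ[ β ∈ D ] P β × Sim x β y γ ⟫
  open Ext

  sim-ord : Sim x β y γ → IsOrd β × IsOrd γ
  sim-ord s = s >>= λ (_ , (oβ , oγ , _) , _) → oβ , oγ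

  Pred : D → D → D → Set
  Pred x β γ = Edge x γ β

  edge-resp : ∀ {β β′ γ γ′} → β ≗ β′ → γ ≗ γ′ → Edge x β γ → Edge x β′ γ′
  edge-resp e f (p , q) = ≺-respˡ e (≺-respʳ f p) , ∋-resp (g-cong e f) q

  sim-unfold : Sim x β y γ → Ext (Pred x β) x (Pred y γ) y
  sim-unfold s = ext
    (λ e → s >>= λ (r , (oβ , oγ , p) , b) → proj₁ (b _ _ oβ oγ p) _ e >>= λ (γ′ , e′ , q) →
      return (γ′ , e′ , return (r , (≺-ordˡ (proj₁ e) , ≺-ordˡ (proj₁ e′) , q) , b)))
    (λ e → s >>= λ (r , (oβ , oγ , p) , b) → proj₂ (b _ _ oβ oγ p) _ e >>= λ (γ′ , e′ , q) →
      return (γ′ , e′ , return (r , (≺-ordˡ (proj₁ e′) , ≺-ordˡ (proj₁ e) , q) , b)))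

  -- Bisimulations are sets, so a bisimulation has to be cut out of the class Sim; bounding the
  -- nodes suffices because the predecessors of a node lie below it.
  sim-fold : IsOrd β → IsOrd γ → Ext (Pred x β) x (Pred y γ) y → Sim x β y γ
  sim-fold {β} {γ} {x} {y} oβ oγ e = larger₂ oβ oγ >>= λ (δ , β≺δ , γ≺δ) →
    -- The pair of `β` and `γ` is added by hand; its predecessors are matched by `e`, those of all
    -- other pairs by `sim-unfold`.
    graph (simᶠ (↑² zero) zero (↑³ zero) (suc zero) ∨ v0 ≐ v4 ∧ v1 ≐ var (↑³ (↑² zero)))
          (x ◂ y ◂ β ◂ γ ◂ ∅) (≺-ordʳ β≺δ) >>= λ (r , h) →
    return (r , (oβ , oγ , proj₂ (h oβ oγ) (β≺δ , γ≺δ , return (inj₂ (≗-refl , ≗-refl)))) ,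
      λ b c ob oc p → let (b≺δ , c≺δ , q) = proj₁ (h ob oc) p in
        (λ b′ e′ → q >>= λ where
           (inj₁ s) → forth (sim-unfold s) e′ >>= λ (c′ , e″ , s′) → return (c′ , e″ ,
             proj₂ (h (≺-ordˡ (proj₁ e′)) (≺-ordˡ (proj₁ e″)))
               (≺-trans (proj₁ e′) b≺δ , ≺-trans (proj₁ e″) c≺δ , return (inj₁ s′)))
           (inj₂ (bβ , cγ)) → forth e (edge-resp ≗-refl bβ e′) >>= λ (c′ , e″ , s′) →
             return (c′ , edge-resp ≗-refl (≗-sym cγ) e″ ,
               proj₂ (h (≺-ordˡ (proj₁ e′)) (≺-ordˡ (proj₁ e″)))
                 (≺-trans (proj₁ e′) b≺δ , ≺-trans (proj₁ e″) γ≺δ , return (inj₁ s′)))) ,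
        (λ c′ e′ → q >>= λ where
           (inj₁ s) → back (sim-unfold s) e′ >>= λ (b′ , e″ , s′) → return (b′ , e″ ,
             proj₂ (h (≺-ordˡ (proj₁ e″)) (≺-ordˡ (proj₁ e′)))
               (≺-trans (proj₁ e″) b≺δ , ≺-trans (proj₁ e′) c≺δ , return (inj₁ s′)))
           (inj₂ (bβ , cγ)) → back e (edge-resp ≗-refl cγ e′) >>= λ (b′ , e″ , s′) →
             return (b′ , edge-resp ≗-refl (≗-sym bβ) e″ ,
               proj₂ (h (≺-ordˡ (proj₁ e″)) (≺-ordˡ (proj₁ e′)))
                 (≺-trans (proj₁ e″) β≺δ , ≺-trans (proj₁ e′) c≺δ , return (inj₁ s′)))))

  -- By `sim-unfold` and `sim-fold`, similarity of two nodes amounts to matching their predecessors.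
  -- So this and the next two laws go by induction on a node, and no inverse or composite of
  -- bisimulations has to be formed as a set.
  sim-refl : IsOrd β → Sim x β x β
  sim-refl {β} {x} oβ = induction (simᶠ (suc zero) zero (suc zero) zero) (x ◂ ∅)
    (λ β oβ ih → sim-fold oβ oβ (ext
      (λ {γ} e → return (γ , e , ih γ (proj₁ e)))
      (λ {γ} e → return (γ , e , ih γ (proj₁ e))))) β oβ

  sim-sym : Sim x β y γ → Sim y γ x β
  sim-sym {x} {β} {y} {γ} s = induction
    (∀′ simᶠ (↑² zero) (suc zero) (↑³ zero) zero ⇒ simᶠ (↑³ zero) zero (↑² zero) (suc zero)) (x ◂ y ◂ ∅)
    (λ β oβ ih γ s → sim-fold (proj₂ (sim-ord s)) oβ (ext
      (λ e → back (sim-unfold s) e >>= λ (β′ , e′ , s′) → return (β′ , e′ , ih β′ (proj₁ e′) _ s′))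
      (λ e → forth (sim-unfold s) e >>= λ (γ′ , e′ , s′) → return (γ′ , e′ , ih _ (proj₁ e) γ′ s′))))
    β (proj₁ (sim-ord s)) γ s

  sim-trans : Sim x β y γ → Sim y γ z δ → Sim x β z δ
  sim-trans {x} {β} {y} {γ} {z} {δ} s t = induction
    (∀′ ∀′ simᶠ (↑³ zero) (↑² zero) (↑³ (suc zero)) (suc zero) ⇒
           simᶠ (↑³ (suc zero)) (suc zero) (↑³ (↑² zero)) zero ⇒
           simᶠ (↑³ zero) (↑² zero) (↑³ (↑² zero)) zero) (x ◂ y ◂ z ◂ ∅)
    (λ β oβ ih γ δ s t → sim-fold oβ (proj₂ (sim-ord t)) (ext
      (λ e → forth (sim-unfold s) e >>= λ (γ′ , e′ , s′) → forth (sim-unfold t) e′ >>= λ (δ′ , e″ , t′) →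
        return (δ′ , e″ , ih _ (proj₁ e) γ′ δ′ s′ t′))
      (λ e → back (sim-unfold t) e >>= λ (γ′ , e′ , t′) → back (sim-unfold s) e′ >>= λ (β′ , e″ , s′) →
        return (β′ , e″ , ih β′ (proj₁ e″) γ′ _ s′ t′))))
    β (proj₁ (sim-ord s)) γ δ s t

  instance
    stable-Ext : Stable (Ext P x Q y)
    stable-Ext = record { stable = λ m → ext (λ p → m >>= λ e → forth e p) (λ q → m >>= λ e → back e q) }

  ext-sym : Ext P x Q y → Ext Q y P x
  ext-sym e = ext
    (λ q → back e q >>= λ (β , p , s) → return (β , p , sim-sym s))
    (λ p → forth e p >>= λ (γ , q , s) → return (γ , q , sim-sym s))

  ext-trans : Ext P x Q y → Ext Q y S z → Ext P x S z
  ext-trans e f = ext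
    (λ p → forth e p >>= λ (γ , q , s) → forth f q >>= λ (δ , r , t) → return (δ , r , sim-trans s t))
    (λ r → back f r >>= λ (γ , q , t) → back e q >>= λ (β , p , s) → return (β , p , sim-trans s t))

  infix 4 _≈_ _ε_

  _≈_ : D → D → Set
  x ≈ y = Ext (Root x) x (Root y) y

  Den : D → D → D → Set
  Den z x β = Ext (Root z) z (Pred x β) x

  _ε_ : D → D → Set
  z ε x = ⟪ Σ[ β ∈ D ] Root x β × Den z x β ⟫

  ≈-refl : x ≈ x
  ≈-refl = ext (λ p → return (_ , p , sim-refl (proj₁ p))) (λ p → return (_ , p , sim-refl (proj₁ p)))

  den-sim : Den z x β → Sim x β y γ → Den z y γ
  den-sim d s = ext-trans d (sim-unfold s)

  den-unique : IsOrd β → IsOrd γ → Den z x β → Den z y γ → Sim x β y γ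
  den-unique oβ oγ d e = sim-fold oβ oγ (ext-trans (ext-sym d) e)

  den-≈ : Den z x β → Den z′ x β → z ≈ z′
  den-≈ d e = ext-trans d (ext-sym e)

  ≈-den : z′ ≈ z → Den z x β → Den z′ x β
  ≈-den = ext-trans

  ε-respˡ : z ≈ z′ → z ε x → z′ ε x
  ε-respˡ e m = m >>= λ (β , r , d) → return (β , r , ≈-den (ext-sym e) d)

  ε-respʳ : x ≈ y → z ε x → z ε y
  ε-respʳ e m = m >>= λ (β , r , d) → forth e r >>= λ (γ , r′ , s) → return (γ , r′ , den-sim d s)

  ε-den : Den y x β → z ε y → ⟪ Σ[ γ ∈ D ] Edge x γ β × Den z x γ ⟫
  ε-den d m = m >>= λ (γ , r , d′) → forth d r >>= λ (γ′ , e , s) → return (γ′ , e , den-sim d′ s)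

  den-ε : Den y x β → Edge x γ β → Den z x γ → z ε y
  den-ε d e d′ = back d e >>= λ (γ′ , r , s) → return (γ′ , r , den-sim d′ (sim-sym s))

  -- Names with new roots

  nodes-bounded : ∀ x → ⟪ Σ[ δ ∈ D ] IsOrd δ ×
    (∀ {β γ} → IsOrd β → IsOrd γ → x ∋ g β γ → β ≺ δ × γ ≺ δ) ⟫
  nodes-bounded x = bounded x >>= λ (δ , oδ , h) → return (δ , oδ , λ {_} {_} oβ oγ p →
    ≼-≺-trans (≼-gˡ oβ oγ) (h _ p) , ≼-≺-trans (≼-gʳ oβ oγ) (h _ p))

  -- Edges and roots use disjoint sets of codes, so `y` can have the edges of `x` and the roots `Ψ`;
  -- a bisimulation of `x` with itself then also relates `x` to `y`. The last clause, which controls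
  -- all codes in `y`, serves `restrict`.
  subname : ∀ x (Ψ : Formula L-SO (suc n)) (σ : Fin n → D) →
            IsOrd δ → (∀ β → IsOrd β → ⟦ Ψ ⟧ (β ◂ σ) → β ≺ δ) →
            ⟪ Σ[ y ∈ D ] (∀ β → IsOrd β → Sim x β y β) × (∀ β → Root y β ↔ IsOrd β × ⟦ Ψ ⟧ (β ◂ σ))
              × (∀ β γ → IsOrd β → IsOrd γ → y ∋ g β γ → ⟪ x ∋ g β γ ⊎ β ≗ γ × ⟦ Ψ ⟧ (β ◂ σ) ⟫) ⟫
  subname {n} x Ψ σ oδ b =
    nodes-bounded x >>= λ (δ′ , oδ′ , b′) → larger₂ oδ oδ′ >>= λ (κ , δ≺κ , δ′≺κ) →
    graph (edgeᶠ (↑² zero) zero (suc zero) ∨ v0 ≐ v1 ∧ rename (lift 1 ↑²) Ψ) (x ◂ σ) (≺-ordʳ δ≺κ) >>= λ (y , h) →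
    let
      edge→ : ∀ {β γ} → Edge y β γ → Edge x β γ
      edge→ = λ (β≺γ , p) → β≺γ , (proj₂ (proj₂ (proj₁ (h (≺-ordˡ β≺γ) (≺-ordʳ β≺γ)) p)) >>= λ where
        (inj₁ (_ , q)) → q
        (inj₂ (e , _)) → explode (≺-irrefl (≺-respˡ e β≺γ)))
      edge← : ∀ {β γ} → Edge x β γ → Edge y β γ
      edge← = λ (β≺γ , p) → β≺γ , (let (q , r) = b′ (≺-ordˡ β≺γ) (≺-ordʳ β≺γ) p in
        proj₂ (h (≺-ordˡ β≺γ) (≺-ordʳ β≺γ)) (≺-trans q δ′≺κ , ≺-trans r δ′≺κ , return (inj₁ (β≺γ , p))))
    in
    return (y ,
      (λ β oβ → same edge→ edge← oβ) ,
      (λ β →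
        (λ (oβ , p) → oβ , (proj₂ (proj₂ (proj₁ (h oβ oβ) p)) >>= λ where
           (inj₁ (q , _)) → explode (≺-irrefl q)
           (inj₂ (_ , q)) → proj₁ (⟦rename⟧ (agree {β} {β}) Ψ) q)) ,
        (λ (oβ , p) → oβ , proj₂ (h oβ oβ) (≺-trans (b β oβ p) δ≺κ , ≺-trans (b β oβ p) δ≺κ ,
           return (inj₂ (≗-refl , proj₂ (⟦rename⟧ (agree {β} {β}) Ψ) p))))) ,
      (λ β γ oβ oγ p → proj₂ (proj₂ (proj₁ (h oβ oγ) p)) >>= λ where
         (inj₁ (_ , q)) → return (inj₁ q)
         (inj₂ (e , q)) → return (inj₂ (e , proj₁ (⟦rename⟧ (agree {β} {γ}) Ψ) q))))
    where
    instance
      stable-Ψ : ∀ {β} → Stable (⟦ Ψ ⟧ (β ◂ σ))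
      stable-Ψ = ⟦⟧-stable Ψ _
    agree : ∀ {β γ} i → (β ◂ γ ◂ x ◂ σ) (lift 1 ↑² i) ≡ (β ◂ σ) i
    agree zero    = refl
    agree (suc i) = refl
    same : ∀ {y} → (∀ {β γ} → Edge y β γ → Edge x β γ) → (∀ {β γ} → Edge x β γ → Edge y β γ) →
           IsOrd β → Sim x β y β
    same f f⁻ oβ = sim-refl oβ >>= λ (r , p , b) → return (r , p , λ β γ oβ oγ q →
      (λ β′ e → proj₁ (b β γ oβ oγ q) β′ e >>= λ (γ′ , e′ , q′) → return (γ′ , f⁻ e′ , q′)) ,
      (λ γ′ e → proj₂ (b β γ oβ oγ q) γ′ (f e) >>= λ (β′ , e′ , q′) → return (β′ , e′ , q′)))

  subname-ε : ∀ x (Ψ : Formula L-SO (suc n)) (σ : Fin n → D) →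
              IsOrd δ → (∀ β → IsOrd β → ⟦ Ψ ⟧ (β ◂ σ) → β ≺ δ) →
              ⟪ Σ[ y ∈ D ] (∀ z → z ε y ↔ ⟪ Σ[ β ∈ D ] IsOrd β × ⟦ Ψ ⟧ (β ◂ σ) × Den z x β ⟫) ⟫
  subname-ε x Ψ σ oδ b = subname x Ψ σ oδ b >>= λ (y , s , r , _) → return (y , λ z →
    (λ m → m >>= λ (β , p , d) → let (oβ , q) = proj₁ (r β) p in
      return (β , oβ , q , den-sim d (sim-sym (s β oβ)))) ,
    (λ m → m >>= λ (β , oβ , q , d) → return (β , proj₂ (r β) (oβ , q) , den-sim d (s β oβ))))

  -- Taking the predecessors of `β` as roots gives an object for what `β` denotes. This is the
  -- passage from nodes to elements.
  node-name : ∀ x → IsOrd β → ⟪ Σ[ z ∈ D ] Den z x β ⟫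
  node-name {β} x oβ = subname x (edgeᶠ (↑² zero) zero (suc zero)) (β ◂ x ◂ ∅) oβ (λ _ _ → proj₁)
    >>= λ (z , s , r , _) → return (z , ext
      (λ {γ} p → let (oγ , e) = proj₁ (r γ) p in return (γ , e , sim-sym (s γ oγ)))
      (λ {γ} e → let oγ = ≺-ordˡ (proj₁ e) in return (γ , proj₂ (r γ) (oγ , e) , sim-sym (s γ oγ))))

  extensional : (∀ z → z ε x ↔ z ε y) → x ≈ y
  extensional {x} {y} h = ext
    (λ {β} p → node-name x (proj₁ p) >>= λ (z , d) → proj₁ (h z) (return (β , p , d)) >>= λ (γ , q , d′) →
      return (γ , q , den-unique (proj₁ p) (proj₁ q) d d′))
    (λ {γ} q → node-name y (proj₁ q) >>= λ (z , d) → proj₂ (h z) (return (γ , q , d)) >>= λ (β , p , d′) →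
      return (β , p , den-unique (proj₁ p) (proj₁ q) d′ d))

  -- The minimum is over all nodes similar to a root of `x`. A common element of `x` and `y` is
  -- denoted by a predecessor of `γ`, which need not be a root but is similar to one, against
  -- minimality.
  foundational : ⟪ Σ[ z ∈ D ] z ε x ⟫ → ⟪ Σ[ y ∈ D ] y ε x × (⟪ Σ[ z ∈ D ] z ε x × z ε y ⟫ → R) ⟫
  foundational {x} m = m >>= λ (z , m) → m >>= λ (β , p , _) →
    least (∃′ rootᶠ (↑² zero) zero ∧ simᶠ (↑² zero) (suc zero) (↑² zero) zero) (x ◂ ∅) (proj₁ p)
      (return (β , p , sim-refl (proj₁ p))) >>= λ (γ , oγ , m , min) → m >>= λ (γ′ , q , s) →
    node-name x oγ >>= λ (y , d) →
    return (y , return (γ′ , q , den-sim d s) , λ k → k >>= λ (z , m , m′) →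
      m >>= λ (δ , r , e) → ε-den d m′ >>= λ (δ′ , edge , e′) →
      min δ′ (proj₁ edge) (return (δ , r , den-unique (≺-ordˡ (proj₁ edge)) (proj₁ r) e′ e)))

  union-exists : ∀ x → ⟪ Σ[ u ∈ D ] (∀ z → z ε u ↔ ⟪ Σ[ y ∈ D ] y ε x × z ε y ⟫) ⟫
  union-exists x = nodes-bounded x >>= λ (δ , oδ , b) →
    subname-ε x (∃′ rootᶠ (↑² zero) zero ∧ edgeᶠ (↑² zero) (suc zero) zero) (x ◂ ∅) oδ
      (λ γ _ m → m >>= λ (β , p , e) → ≺-trans (proj₁ e) (proj₁ (b (proj₁ p) (proj₁ p) (proj₂ p))))
    >>= λ (u , h) → return (u , λ z →
      (λ m → proj₁ (h z) m >>= λ (γ , oγ , m , d) → m >>= λ (β , p , e) →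
        node-name x (proj₁ p) >>= λ (y , d′) → return (y , return (β , p , d′) , den-ε d′ e d)) ,
      (λ m → m >>= λ (y , m , m′) → m >>= λ (β , p , d) → ε-den d m′ >>= λ (γ , e , d′) →
        proj₂ (h z) (return (γ , ≺-ordˡ (proj₁ e) , return (β , p , e) , d′))))

  module _ (φ : Formula L-SO (suc n)) (σ : Fin n → D)
           (invariant : ∀ {z z′} → z ≈ z′ → ⟦ φ ⟧ (z ◂ σ) → ⟦ φ ⟧ (z′ ◂ σ)) where

    private
      Class : D → Set
      Class z = ⟦ φ ⟧ (z ◂ σ)

      instance
        stable-Class : ∀ {z} → Stable (⟦ φ ⟧ (z ◂ σ))
        stable-Class = ⟦⟧-stable φ _

    separate : ∀ x → ⟪ Σ[ y ∈ D ] (∀ z → z ε y ↔ z ε x × Class z) ⟫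
    separate x = nodes-bounded x >>= λ (δ , oδ , b) →
      subname-ε x (rootᶠ (suc zero) zero ∧ (∃′ denᶠ zero (↑² zero) (suc zero) ∧ rename (lift 1 ↑²) φ)) (x ◂ σ) oδ
        (λ β oβ (p , _) → proj₁ (b oβ oβ (proj₂ p)))
      >>= λ (y , h) → return (y , λ z →
        (λ m → proj₁ (h z) m >>= λ (β , oβ , (p , m) , d) → m >>= λ (w , (f , b) , c) →
          return (β , p , d) , invariant (den-≈ (ext (λ {γ} → f γ) (λ {γ} → b γ)) d) (proj₁ (⟦rename⟧ (agree {w} {β}) φ) c)) ,
        (λ (m , c) → m >>= λ (β , p , d) → proj₂ (h z) (return (β , proj₁ p , (p ,
          return (z , ((λ _ → forth d) , λ _ → back d) , proj₂ (⟦rename⟧ (agree {z} {β}) φ) c)) , d))))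
      where
      agree : ∀ {z β} i → (z ◂ β ◂ x ◂ σ) (lift 1 ↑² i) ≡ (z ◂ σ) i
      agree zero    = refl
      agree (suc i) = refl

  -- Collecting a bounded class

  ord-resp : α ≗ β → IsOrd α → IsOrd β
  ord-resp = ≐-subst (Ord v0) ∅

  Section : D → D → D → Set
  Section b ξ z = ∀ x → IsOrd x → z ∋ x ↔ b ∋ g x ξ

  module _ (φ : Formula L-SO (suc n)) (σ : Fin n → D)
           (invariant : ∀ {z z′} → z ≈ z′ → ⟦ φ ⟧ (z ◂ σ) → ⟦ φ ⟧ (z′ ◂ σ)) where

    private
      Class : D → Set
      Class z = ⟦ φ ⟧ (z ◂ σ)

      instance
        stable-Class : ∀ {z} → Stable (⟦ φ ⟧ (z ◂ σ))
        stable-Class = ⟦⟧-stable φ _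

      -- In the name of the family of all sections of b in the class, g ξ γ is the copy of the
      -- node γ of the section at ξ, and g ξ θ is the node that denotes this section.
      module Family (b θ : D) (oθ : IsOrd θ) (b<θ : ∀ x → b ∋ x → x ≺ θ) where

        Index : D → Set
        Index ξ = ⟪ Σ[ z ∈ D ] Section b ξ z × Class z ⟫

        -- The name of the singleton of the section: its own edges, an edge from each of its roots
        -- to the new top node `θ`, and a diagonal code that makes `θ` the only root.
        Link : D → D → D → Set
        Link ξ γ γ′ = ⟪ (γ ≺ γ′ × γ′ ≺ θ × b ∋ g (g γ γ′) ξ)
                      ⊎ ⟪ (γ ≺ θ × γ′ ≗ θ × b ∋ g (g γ γ) ξ) ⊎ (γ ≗ θ × γ′ ≗ θ) ⟫ ⟫

        link-resp : ∀ {ξ ξ′ γ γ′ γ″} → ξ ≗ ξ′ → γ′ ≗ γ″ → Link ξ γ γ′ → Link ξ′ γ γ″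
        link-resp e f m = m >>= λ where
          (inj₁ (p , q , r)) → return (inj₁ (≺-respʳ f p , ≺-respˡ f q , ∋-resp (g-cong (g-cong ≗-refl f) e) r))
          (inj₂ m) → m >>= λ where
            (inj₁ (p , q , r)) → return (inj₂ (return (inj₁ (p , ≗-trans (≗-sym f) q , ∋-resp (g-cong ≗-refl e) r))))
            (inj₂ (p , q)) → return (inj₂ (return (inj₂ (p , ≗-trans (≗-sym f) q))))

        link-bound : ∀ {ξ γ γ′} → Link ξ γ γ′ → γ ≼ θ × γ′ ≼ θ
        link-bound m = m >>= λ where
          (inj₁ (p , q , r)) → ≺⇒≼ (≺-trans p q) , ≺⇒≼ q
          (inj₂ m) → m >>= λ where
            (inj₁ (p , q , r)) → ≺⇒≼ p , return (inj₂ q)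
            (inj₂ (p , q)) → return (inj₂ p) , return (inj₂ q)

        Arrow : D → D → Set
        Arrow u v = ⟪ Σ[ ξ ∈ D ] ⟪ Σ[ γ ∈ D ] IsOrd γ × ⟪ Σ[ γ′ ∈ D ] IsOrd γ′ ×
          (ξ ≺ θ × Index ξ × u ≗ g ξ γ × v ≗ g ξ γ′ × Link ξ γ γ′) ⟫ ⟫ ⟫

        indexᶠ : Formula L-SO (suc (suc n))
        indexᶠ = ∃′ (∀′ Ord v0 ⇒ (v0 ∈′ v1 ⇔ G v0 v3 ∈′ v2)) ∧ rename (lift 1 ↑²) φ

        index↔ : ∀ {ξ} → ⟦ indexᶠ ⟧ (b ◂ ξ ◂ σ) ↔ Index ξ
        index↔ {ξ} = (λ m → m >>= λ (z , s , c) → return (z , s , proj₁ (⟦rename⟧ (agree {z}) φ) c)) ,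
                     (λ m → m >>= λ (z , s , c) → return (z , s , proj₂ (⟦rename⟧ (agree {z}) φ) c))
          where
          agree : ∀ {z} i → (z ◂ b ◂ ξ ◂ σ) (lift 1 ↑² i) ≡ (z ◂ σ) i
          agree zero    = refl
          agree (suc i) = refl

        shuffle : Fin (suc (suc n)) → Fin (suc (suc (suc (suc (suc (suc (suc n)))))))
        shuffle = ↑³ (↑² zero) ◂ ↑² zero ◂ λ i → ↑³ (↑³ (suc i))

        arrowᶠ : Formula L-SO (suc (suc (suc (suc n))))
        arrowᶠ = ∃′ ∃′ Ord v0 ∧ (∃′ Ord v0 ∧
          (v2 < θ′ ∧ rename shuffle indexᶠ ∧ v3 ≐ G v2 v1 ∧ v4 ≐ G v2 v0 ∧
            (v1 < v0 ∧ v0 < θ′ ∧ G (G v1 v0) v2 ∈′ b′ ∨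
             (v1 < θ′ ∧ v0 ≐ θ′ ∧ G (G v1 v1) v2 ∈′ b′ ∨ v1 ≐ θ′ ∧ v0 ≐ θ′))))
          where
          b′ θ′ : Term L-SO (suc (suc (suc (suc (suc (suc (suc n)))))))
          b′ = var (↑³ (↑² zero))
          θ′ = var (↑³ (↑³ zero))

        arrow↔ : ∀ {u v} → ⟦ arrowᶠ ⟧ (u ◂ v ◂ b ◂ θ ◂ σ) ↔ Arrow u v
        arrow↔ {u} {v} =
          (λ m → m >>= λ (ξ , m) → m >>= λ (γ , oγ , m) → m >>= λ (γ′ , oγ′ , p , i , q) →
            return (ξ , return (γ , oγ , return (γ′ , oγ′ , p ,
              proj₁ index↔ (proj₁ (⟦rename⟧ (agree {γ′} {γ} {ξ}) indexᶠ) i) , q)))) ,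
          (λ m → m >>= λ (ξ , m) → m >>= λ (γ , oγ , m) → m >>= λ (γ′ , oγ′ , p , i , q) →
            return (ξ , return (γ , oγ , return (γ′ , oγ′ , p ,
              proj₂ (⟦rename⟧ (agree {γ′} {γ} {ξ}) indexᶠ) (proj₂ index↔ i) , q))))
          where
          agree : ∀ {γ′ γ ξ} i → (γ′ ◂ γ ◂ ξ ◂ u ◂ v ◂ b ◂ θ ◂ σ) (shuffle i) ≡ (b ◂ ξ ◂ σ) i
          agree zero          = refl
          agree (suc zero)    = refl
          agree (suc (suc i)) = refl

        module Copies (y Δ : D) (θ<Δ : ∀ {ξ γ} → ξ ≺ θ → γ ≼ θ → g ξ γ ≺ Δ)
                      (h : ∀ {u v} → IsOrd u → IsOrd v → y ∋ g u v ↔ (u ≺ Δ × v ≺ Δ × ⟦ arrowᶠ ⟧ (u ◂ v ◂ b ◂ θ ◂ σ)))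
                      where

          arrow-in : ∀ {ξ γ γ′} → IsOrd γ → IsOrd γ′ → ξ ≺ θ → Index ξ → Link ξ γ γ′ → y ∋ g (g ξ γ) (g ξ γ′)
          arrow-in oγ oγ′ p i l = proj₂ (h g-ord g-ord)
            (θ<Δ p (proj₁ (link-bound l)) , θ<Δ p (proj₂ (link-bound l)) ,
             proj₂ arrow↔ (return (_ , return (_ , oγ , return (_ , oγ′ , p , i , ≗-refl , ≗-refl , l)))))

          arrow-out : ∀ {u ξ γ′} → IsOrd u → IsOrd ξ → IsOrd γ′ → y ∋ g u (g ξ γ′) →
                      ⟪ Σ[ γ ∈ D ] IsOrd γ × u ≗ g ξ γ × Link ξ γ γ′ ⟫
          arrow-out ou oξ oγ′ p = proj₁ arrow↔ (proj₂ (proj₂ (proj₁ (h ou g-ord) p))) >>= λ (ξ₁ , m) →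
            m >>= λ (γ₁ , oγ₁ , m) → m >>= λ (γ₁′ , oγ₁′ , q , _ , e , e′ , l) →
            let (f , f′) = g-injective oξ oγ′ (≺-ordˡ q) oγ₁′ e′ in
            return (γ₁ , oγ₁ , ≗-trans e (g-cong (≗-sym f) ≗-refl) , link-resp (≗-sym f) (≗-sym f′) l)

          -- Injectivity of `g` makes every predecessor of a copy a copy with the same `ξ`, so
          -- different sections do not interfere. The quantifier over `u` is there for the
          -- induction, as predecessors are codes only up to `≗`.
          copy : ∀ {ξ w} → ξ ≺ θ → Index ξ → Section b ξ w →
                 ∀ γ → IsOrd γ → γ ≺ θ → ∀ u → u ≗ g ξ γ → Sim y u w γ
          copy {ξ} {w} ξ≺θ i s = induction
            (v0 < var (suc zero) ⇒ (∀′ v0 ≐ G (var (↑³ zero)) v1 ⇒ simᶠ (↑³ (suc zero)) zero (↑³ (↑² zero)) (suc zero)))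
            (θ ◂ ξ ◂ y ◂ w ◂ ∅) λ γ oγ ih γ≺θ u e → sim-fold (ord-resp (≗-sym e) g-ord) oγ (ext
              (λ {u′} (u′≺u , p) →
                arrow-out (≺-ordˡ u′≺u) (≺-ordˡ ξ≺θ) oγ (∋-resp (g-cong ≗-refl e) p) >>= λ (γ′ , oγ′ , e′ , l) →
                l >>= λ where
                  (inj₁ (q , _ , r)) → return (γ′ , (q , proj₂ (s _ g-ord) r) , ih γ′ q (≺-trans q γ≺θ) u′ e′)
                  (inj₂ m) → m >>= λ where
                    (inj₁ (_ , q , _)) → explode (≺-irrefl (≺-respˡ q γ≺θ))
                    (inj₂ (_ , q)) → explode (≺-irrefl (≺-respˡ q γ≺θ)))
              (λ {γ′} (γ′≺γ , p) → return (g ξ γ′ ,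
                (≺-respʳ (≗-sym e) (g-monoʳ (≺-ordˡ ξ≺θ) γ′≺γ) ,
                 ∋-resp (g-cong ≗-refl (≗-sym e)) (arrow-in (≺-ordˡ γ′≺γ) oγ ξ≺θ i
                   (return (inj₁ (γ′≺γ , γ≺θ , proj₁ (s _ g-ord) p))))) ,
                ih γ′ γ′≺γ (≺-trans γ′≺γ γ≺θ) (g ξ γ′) ≗-refl)))

          section-den : ∀ {ξ w u} → ξ ≺ θ → Index ξ → Section b ξ w → u ≗ g ξ θ → Den w y u
          section-den {ξ} {w} {u} ξ≺θ i s e = ext
            (λ {γ} (oγ , p) →
              let q = proj₁ (s _ g-ord) p
                  -- A node is at most each code it occurs in, hence below the bound of `b`; this is
                  -- why `θ` is free to be the top node.
                  γ≺θ = ≼-≺-trans (≼-gˡ oγ oγ) (≼-≺-trans (≼-gˡ g-ord (≺-ordˡ ξ≺θ)) (b<θ _ q))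
              in return (g ξ γ , (≺-respʳ (≗-sym e) (g-monoʳ (≺-ordˡ ξ≺θ) γ≺θ) ,
                ∋-resp (g-cong ≗-refl (≗-sym e)) (arrow-in oγ oθ ξ≺θ i (return (inj₂ (return (inj₁ (γ≺θ , ≗-refl , q))))))) ,
                sim-sym (copy ξ≺θ i s γ oγ γ≺θ _ ≗-refl)))
            (λ {u′} (u′≺u , p) →
              arrow-out (≺-ordˡ u′≺u) (≺-ordˡ ξ≺θ) oθ (∋-resp (g-cong ≗-refl e) p) >>= λ (γ , oγ , e′ , l) →
              l >>= λ where
                (inj₁ (_ , q , _)) → explode (≺-irrefl q)
                (inj₂ m) → m >>= λ where
                  (inj₁ (q , _ , r)) → return (γ , (oγ , proj₂ (s _ g-ord) r) , sim-sym (copy ξ≺θ i s γ oγ q u′ e′))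
                  -- The diagonal code at `θ` is no edge: it would give `u′ ≗ u`.
                  (inj₂ (q , _)) → explode (≺-irrefl (≺-respʳ (≗-trans e (≗-trans (g-cong ≗-refl (≗-sym q)) (≗-sym e′))) u′≺u)))

          root-out : ∀ {u} → Root y u → ⟪ Σ[ ξ ∈ D ] ξ ≺ θ × Index ξ × u ≗ g ξ θ ⟫
          root-out (ou , p) = proj₁ arrow↔ (proj₂ (proj₂ (proj₁ (h ou ou) p))) >>= λ (ξ , m) →
            m >>= λ (γ , oγ , m) → m >>= λ (γ′ , oγ′ , ξ≺θ , i , e , e′ , l) →
            let f = proj₂ (g-injective (≺-ordˡ ξ≺θ) oγ (≺-ordˡ ξ≺θ) oγ′ (≗-trans (≗-sym e) e′)) in
            l >>= λ where
              (inj₁ (q , _)) → explode (≺-irrefl (≺-respˡ f q))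
              (inj₂ m) → m >>= λ where
                (inj₁ (q , r , _)) → explode (≺-irrefl (≺-respˡ (≗-trans f r) q))
                (inj₂ (q , _)) → return (ξ , ξ≺θ , i , ≗-trans e (g-cong ≗-refl q))

          root-in : ∀ {ξ} → ξ ≺ θ → Index ξ → Root y (g ξ θ)
          root-in p i = g-ord , arrow-in oθ oθ p i (return (inj₂ (return (inj₂ (≗-refl , ≗-refl)))))

    -- Up to `≈`, every member of the class is a section of `b`. All sections that lie in the class
    -- are put into the family, so no representatives are chosen.
    collect : IsOrd α → (∀ z → Class z → ⟪ Σ[ z′ ∈ D ] (∀ x → z′ ∋ x → x ≺ α) × z′ ≈ z ⟫) →
              ⟪ Σ[ y ∈ D ] (∀ z → z ε y ↔ Class z) ⟫
    collect oα small = powerset oα >>= λ (b , θ , oθ , b<θ , sections) → larger oθ >>= λ (θ′ , θ≺θ′) →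
      let open Family b θ oθ b<θ in
      -- The bound uses `θ′` above `θ` because the top node `θ` occurs as a second coordinate.
      graph arrowᶠ (b ◂ θ ◂ σ) (g-ord {θ′} {θ′}) >>= λ (y , h) →
      let open Copies y (g θ′ θ′) (λ p q → g-mono₂ (≺-trans p θ≺θ′) (≼-≺-trans q θ≺θ′)) h in
      return (y , λ z →
        (λ m → m >>= λ (u , r , d) → root-out r >>= λ (ξ , ξ≺θ , i , e) → i >>= λ (w , s , c) →
          invariant (den-≈ (section-den ξ≺θ i s e) d) c) ,
        (λ c → small z c >>= λ (z′ , z′⊆α , e) → sections z′ z′⊆α >>= λ (ξ , ξ≺θ , s) →
          let i = return (z′ , s , invariant (ext-sym e) c) in
          ε-respˡ e (return (g ξ θ , root-in ξ≺θ i , section-den ξ≺θ i s ≗-refl))))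

  -- The existence axioms and choice

  Extᵖ : (D → Set) → D → (D → Set) → D → Set
  Extᵖ P x Q y = (∀ β → P β → ⟪ Σ[ γ ∈ D ] Q γ × Sim x β y γ ⟫) ×
                 (∀ γ → Q γ → ⟪ Σ[ β ∈ D ] P β × Sim x β y γ ⟫)

  -- `Extᵖ` is what `≈ᶠ` and `denᶠ` compute to, while the record `Ext` lets `P` and `Q` be inferred.
  pack : Extᵖ P x Q y → Ext P x Q y
  pack (f , b) = ext (λ {β} → f β) (λ {γ} → b γ)

  unpack : Ext P x Q y → Extᵖ P x Q y
  unpack e = (λ _ → forth e) , (λ _ → back e)

  ε-pack : ⟪ Σ[ β ∈ D ] Root x β × Extᵖ (Root z) z (Pred x β) x ⟫ → z ε x
  ε-pack m = m >>= λ (β , r , p) → return (β , r , pack p)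

  ε-unpack : z ε x → ⟪ Σ[ β ∈ D ] Root x β × Extᵖ (Root z) z (Pred x β) x ⟫
  ε-unpack m = m >>= λ (β , r , e) → return (β , r , unpack e)

  pair-exists : ∀ x y → ⟪ Σ[ p ∈ D ] (∀ z → z ε p ↔ ⟪ z ≈ x ⊎ z ≈ y ⟫) ⟫
  pair-exists x y =
    bounded x >>= λ (α , oα , x<α) → bounded y >>= λ (β , oβ , y<β) → larger₂ oα oβ >>= λ (γ , α≺γ , β≺γ) →
    collect (≈ᶠ zero (suc zero) ∨ ≈ᶠ zero (↑² zero)) (x ◂ y ◂ ∅)
      (λ e m → from (to m >>= λ where
        (inj₁ p) → return (inj₁ (ext-trans (ext-sym e) p))
        (inj₂ p) → return (inj₂ (ext-trans (ext-sym e) p))))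
      (≺-ordʳ α≺γ)
      (λ z m → to m >>= λ where
        (inj₁ p) → return (x , (λ c q → ≺-trans (x<α c q) α≺γ) , ext-sym p)
        (inj₂ p) → return (y , (λ c q → ≺-trans (y<β c q) β≺γ) , ext-sym p))
    >>= λ (p , h) → return (p , λ z → to ∘ proj₁ (h z) , proj₂ (h z) ∘ from)
    where
    to : ⟪ Extᵖ (Root z) z (Root x) x ⊎ Extᵖ (Root z) z (Root y) y ⟫ → ⟪ z ≈ x ⊎ z ≈ y ⟫
    to m = m >>= λ where
      (inj₁ p) → return (inj₁ (pack p))
      (inj₂ p) → return (inj₂ (pack p))
    from : ⟪ z ≈ x ⊎ z ≈ y ⟫ → ⟪ Extᵖ (Root z) z (Root x) x ⊎ Extᵖ (Root z) z (Root y) y ⟫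
    from m = m >>= λ where
      (inj₁ p) → return (inj₁ (unpack p))
      (inj₂ p) → return (inj₂ (unpack p))

  _⊑_ : D → D → Set
  z ⊑ x = ∀ β → Root z β → ⟪ Σ[ γ ∈ D ] Root x γ × Sim z β x γ ⟫

  ⊑⇒⊆ : z ⊑ x → ∀ w → w ε z → w ε x
  ⊑⇒⊆ s w m = m >>= λ (β , r , d) → s β r >>= λ (γ , r′ , t) → return (γ , r′ , den-sim d t)

  ⊆⇒⊑ : (∀ w → w ε z → w ε x) → z ⊑ x
  ⊆⇒⊑ {z} s β r = node-name z (proj₁ r) >>= λ (w , d) → s w (return (β , r , d)) >>= λ (γ , r′ , d′) →
    return (γ , r′ , den-unique (proj₁ r) (proj₁ r′) d d′)

  -- An arbitrary name of a subset may be unboundedly large. Keeping the edges of `x` and only those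
  -- of its roots that are similar to roots of `z` gives one inside `x`, which supplies the bound
  -- for power sets.
  restrict : ∀ x z → z ⊑ x → ⟪ Σ[ z′ ∈ D ] (∀ c → z′ ∋ c → x ∋ c) × z′ ≈ z ⟫
  restrict x z s = nodes-bounded x >>= λ (δ , oδ , b) →
    subname x (rootᶠ (suc zero) zero ∧ (∃′ rootᶠ (↑³ zero) zero ∧ simᶠ (↑² zero) (suc zero) (↑³ zero) zero))
      (x ◂ z ◂ ∅) oδ (λ β oβ (p , _) → proj₁ (b oβ oβ (proj₂ p))) >>= λ (y , t , r , codes) →
    return (y ,
      -- SUR makes every element of `y` a code, so that `codes` applies.
      (λ c p → sound sur ∅ c (∋-ord p) >>= λ (β , oβ , m) → m >>= λ (γ , oγ , e) →
        codes β γ oβ oγ (∋-resp e p) >>= λ where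
          (inj₁ q) → ∋-resp (≗-sym e) q
          (inj₂ (f , (_ , q) , _)) → ∋-resp (≗-trans (g-cong ≗-refl f) (≗-sym e)) q) ,
      ext
        (λ {β} p → let (oβ , _ , m) = proj₁ (r β) p in m >>= λ (γ , q , u) →
          return (γ , q , sim-trans (sim-sym (t β oβ)) u))
        (λ {γ} q → s γ q >>= λ (β , p , u) →
          return (β , proj₂ (r β) (proj₁ p , p , return (γ , q , sim-sym u)) ,
            sim-trans (sim-sym (t β (proj₁ p))) (sim-sym u))))

  power-exists : ∀ x → ⟪ Σ[ p ∈ D ] (∀ z → z ε p ↔ (∀ w → w ε z → w ε x)) ⟫
  power-exists x = bounded x >>= λ (α , oα , x<α) →
    collect (∀′ rootᶠ (suc zero) zero ⇒ (∃′ rootᶠ (↑³ zero) zero ∧ simᶠ (↑² zero) (suc zero) (↑³ zero) zero)) (x ◂ ∅)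
      (λ e s → ⊆⇒⊑ (λ w m → ⊑⇒⊆ s w (ε-respʳ (ext-sym e) m)))
      oα
      (λ z s → restrict x z s >>= λ (z′ , i , e) → return (z′ , (λ c p → x<α c (i c p)) , e))
    >>= λ (p , h) → return (p , λ z → (λ m → ⊑⇒⊆ (proj₁ (h z) m)) , λ s → proj₂ (h z) (⊆⇒⊑ s))

  den-resp : β ≗ γ → Den z x β → Den z x γ
  den-resp e d = ext
    (λ p → forth d p >>= λ (β′ , q , s) → return (β′ , edge-resp ≗-refl e q , s))
    (λ q → back d (edge-resp ≗-refl (≗-sym e) q))

  -- For a limit `ω`, let every node below it be a root with all smaller ordinals as predecessors.
  -- Each node then denotes a von Neumann ordinal, and successors are least larger nodes.
  infinity-exists : ⟪ Σ[ x ∈ D ] ⟪ Σ[ e ∈ D ] e ε x × (∀ z → z ε e → R) ⟫ ×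
    (∀ y → y ε x → ⟪ Σ[ s ∈ D ] s ε x × (∀ z → z ε s ↔ ⟪ z ε y ⊎ z ≈ y ⟫) ⟫) ⟫
  infinity-exists = sound inf ∅ >>= λ (ω , oω , m , limit) → m >>= λ (β , oβ , β≺ω) →
    graph (v0 < v1 ∨ v0 ≐ v1) ∅ oω >>= λ (x , h) →
    let
      edge : ∀ {β γ} → β ≺ γ → γ ≺ ω → Edge x β γ
      edge = λ p q → p , proj₂ (h (≺-ordˡ p) (≺-ordʳ p)) (≺-trans p q , q , return (inj₁ p))
      root : ∀ {β} → β ≺ ω → Root x β
      root = λ p → ≺-ordˡ p , proj₂ (h (≺-ordˡ p) (≺-ordˡ p)) (p , p , return (inj₂ ≗-refl))
      root⁻ : ∀ {β} → Root x β → β ≺ ω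
      root⁻ = λ (oβ , p) → proj₁ (proj₁ (h oβ oβ) p)
    in return (x ,
      (least (v0 < v1) (ω ◂ ∅) oβ β≺ω >>= λ (o , oo , o≺ω , min) → node-name x oo >>= λ (e , d) →
        return (e , return (o , root o≺ω , d) , λ z m → ε-den d m >>= λ (γ , (γ≺o , _) , _) →
          min γ γ≺o (≺-trans γ≺o o≺ω))) ,
      (λ y m → m >>= λ (β , r , d) → limit β (proj₁ r) (root⁻ r) >>= λ (γ , oγ , p) →
        least (v1 < v0 ∧ v0 < v2) (β ◂ ω ◂ ∅) oγ p >>= λ (γ , oγ , (β≺γ , γ≺ω) , min) →
        node-name x oγ >>= λ (s , d′) →
        return (s , return (γ , root γ≺ω , d′) , λ z →
          (λ m → ε-den d′ m >>= λ (δ , (δ≺γ , _) , d″) →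
            ⊀⇒≽ (proj₁ r) (≺-ordˡ δ≺γ) (λ β≺δ → min δ δ≺γ (β≺δ , ≺-trans δ≺γ γ≺ω)) >>= λ where
              (inj₁ δ≺β) → return (inj₁ (den-ε d (edge δ≺β (root⁻ r)) d″))
              (inj₂ e) → return (inj₂ (den-≈ (den-resp e d″) d))) ,
          (λ m → m >>= λ where
            (inj₁ m) → ε-den d m >>= λ (δ , (δ≺β , _) , d″) →
              den-ε d′ (edge (≺-trans δ≺β β≺γ) γ≺ω) d″
            (inj₂ e) → den-ε d′ (edge β≺γ γ≺ω) (≈-den e d)))))

  -- The set denoted by the node γ, which need not lie below β, belongs to the one denoted by β.
  Candidate : D → D → D → Set
  Candidate x β γ = ⟪ Σ[ γ′ ∈ D ] Edge x γ′ β × Sim x γ x γ′ ⟫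

  candidate-sim : Sim x β x α → Candidate x β γ → Candidate x α γ
  candidate-sim s m = m >>= λ (γ′ , e , t) → forth (sim-unfold s) e >>= λ (γ″ , e′ , t′) →
    return (γ″ , e′ , sim-trans t t′)

  -- From each member the element denoted by its least candidate is chosen. Candidates are closed
  -- under similarity, so by `candidate-sim` all roots that denote the same member yield the same
  -- ordinal.
  choice-exists : ∀ x → (∀ y → y ε x → ⟪ Σ[ z ∈ D ] z ε y ⟫) ×
    (∀ y y′ → y ε x × y′ ε x × ⟪ Σ[ z ∈ D ] z ε y × z ε y′ ⟫ → y ≈ y′) →
    ⟪ Σ[ c ∈ D ] (∀ y → y ε x →
      ⟪ Σ[ z ∈ D ] (z ε y × z ε c) × (∀ z′ → z′ ε y × z′ ε c → z′ ≈ z) ⟫) ⟫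
  choice-exists x (nonempty , disjoint) = nodes-bounded x >>= λ (δ , oδ , b) →
    subname-ε x
      (∃′ rootᶠ (↑² zero) zero ∧ candidateᶠ (↑² zero) zero (suc zero) ∧
          (∀′ v0 < v2 ⇒ ¬′ candidateᶠ (↑³ zero) (suc zero) zero))
      (x ◂ ∅) oδ
      -- A least candidate is at most some actual predecessor of the root, hence below `δ`.
      (λ γ oγ m → m >>= λ (β , r , c , min) → c >>= λ (γ′ , e , s) →
        ≼-≺-trans (⊀⇒≽ (≺-ordˡ (proj₁ e)) oγ λ γ′≺γ → min γ′ γ′≺γ (return (γ′ , e , sim-refl (≺-ordˡ (proj₁ e)))))
                  (≺-trans (proj₁ e) (proj₁ (b (proj₁ r) (proj₁ r) (proj₂ r)))))
    >>= λ (c , h) → return (c , λ y y∈x → y∈x >>= λ (β , r , d) →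
      nonempty y y∈x >>= λ (w , w∈y) → ε-den d w∈y >>= λ (γ₀ , e₀ , _) →
      least (candidateᶠ (↑² zero) (suc zero) zero) (β ◂ x ◂ ∅) (≺-ordˡ (proj₁ e₀))
        (return (γ₀ , e₀ , sim-refl (≺-ordˡ (proj₁ e₀)))) >>= λ (γ , oγ , cand , min) →
      node-name x oγ >>= λ (z , dz) → cand >>= λ (γ′ , e , s) →
      return (z , (den-ε d e (den-sim dz s) ,
                   proj₂ (h z) (return (γ , oγ , return (β , r , cand , min) , dz))) ,
        λ z′ (z′∈y , z′∈c) → proj₁ (h z′) z′∈c >>= λ (γ₁ , oγ₁ , m , dz′) → m >>= λ (β₁ , r₁ , cand₁ , min₁) →
          node-name x (proj₁ r₁) >>= λ (y₁ , d₁) → cand₁ >>= λ (γ₁′ , e₁ , s₁) →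
          let y≈y₁ = disjoint y y₁ (y∈x , return (β₁ , r₁ , d₁) ,
                       return (z′ , z′∈y , den-ε d₁ e₁ (den-sim dz′ s₁)))
              ββ₁ = den-unique (proj₁ r) (proj₁ r₁) d (≈-den y≈y₁ d₁)
          in ≺-tri oγ oγ₁ >>= λ where
               (inj₁ p) → explode (min₁ γ p (candidate-sim ββ₁ cand))
               (inj₂ (inj₁ p)) → den-≈ dz′ (den-resp p dz)
               (inj₂ (inj₂ p)) → explode (min γ₁ p (candidate-sim (sim-sym ββ₁) cand₁))))

  module _ (φ : Formula L-SO (suc (suc n))) (σ : Fin n → D)
           (invariant : ∀ {x x′ y y′} → x ≈ x′ → y ≈ y′ → ⟦ φ ⟧ (x ◂ y ◂ σ) → ⟦ φ ⟧ (x′ ◂ y′ ◂ σ))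
           (functional : ∀ x y y′ → ⟦ φ ⟧ (x ◂ y ◂ σ) → ⟦ φ ⟧ (x ◂ y′ ◂ σ) → y ≈ y′) where

    private
      module Bound (a : D) where

        boundsᶠ : Formula L-SO (suc (suc (suc n)))
        boundsᶠ = ∃′ ∃′ denᶠ (suc zero) (↑³ (suc zero)) (↑³ zero) ∧ rename (suc zero ◂ zero ◂ (λ i → ↑³ (↑² i))) φ ∧
                        (∀′ (v0 ∈′ v1 ⇒ v0 < v3))

        Bounds : D → D → Set
        Bounds κ β = ⟪ Σ[ x ∈ D ] ⟪ Σ[ y ∈ D ] Den x a β × ⟦ φ ⟧ (x ◂ y ◂ σ) × (∀ c → y ∋ c → c ≺ κ) ⟫ ⟫

        bounds↔ : ∀ {κ β} → ⟦ boundsᶠ ⟧ (κ ◂ β ◂ a ◂ σ) ↔ Bounds κ β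
        bounds↔ {κ} {β} =
          (λ m → m >>= λ (x , m) → m >>= λ (y , d , p , b) →
            return (x , return (y , pack d , proj₁ (⟦rename⟧ (agree {x} {y}) φ) p , b))) ,
          (λ m → m >>= λ (x , m) → m >>= λ (y , d , p , b) →
            return (x , return (y , unpack d , proj₂ (⟦rename⟧ (agree {x} {y}) φ) p , b)))
          where
          agree : ∀ {x y} i → (y ◂ x ◂ κ ◂ β ◂ a ◂ σ) ((suc zero ◂ zero ◂ (λ i → ↑³ (↑² i))) i) ≡ (x ◂ y ◂ σ) i
          agree zero          = refl
          agree (suc zero)    = refl
          agree (suc (suc i)) = refl

        leastᶠ : Formula L-SO (suc (suc (suc n)))
        leastᶠ = rename (suc zero ◂ zero ◂ ↑²) boundsᶠ ∧ (∀′ v0 < v2 ⇒ ¬′ rename (lift 2 suc) boundsᶠ)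

        least↔ : ∀ {β κ} → ⟦ leastᶠ ⟧ (β ◂ κ ◂ a ◂ σ) ↔ (Bounds κ β × (∀ κ′ → κ′ ≺ κ → Bounds κ′ β → R))
        least↔ {β} {κ} =
          (λ (p , q) → proj₁ bounds↔ (proj₁ (⟦rename⟧ agree boundsᶠ) p) ,
                       λ κ′ r s → q κ′ r (proj₂ (⟦rename⟧ (agree′ {κ′}) boundsᶠ) (proj₂ bounds↔ s))) ,
          (λ (p , q) → proj₂ (⟦rename⟧ agree boundsᶠ) (proj₂ bounds↔ p) ,
                       λ κ′ r s → q κ′ r (proj₁ bounds↔ (proj₁ (⟦rename⟧ (agree′ {κ′}) boundsᶠ) s)))
          where
          agree : ∀ i → (β ◂ κ ◂ a ◂ σ) ((suc zero ◂ zero ◂ ↑²) i) ≡ (κ ◂ β ◂ a ◂ σ) i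
          agree zero          = refl
          agree (suc zero)    = refl
          agree (suc (suc i)) = refl
          agree′ : ∀ {κ′} i → (κ′ ◂ β ◂ κ ◂ a ◂ σ) (lift 2 suc i) ≡ (κ′ ◂ β ◂ a ◂ σ) i
          agree′ zero          = refl
          agree′ (suc zero)    = refl
          agree′ (suc (suc i)) = refl

    -- REP yields sets of ordinals and wants a functional formula, but an image has no canonical
    -- name. So REP is applied to the least ordinal that bounds some name of the image of node `β`;
    -- a bound of these ordinals serves `collect`.
    replace : ∀ a → ⟪ Σ[ b ∈ D ] (∀ y → y ε b ↔ ⟪ Σ[ x ∈ D ] x ε a × ⟦ φ ⟧ (x ◂ y ◂ σ) ⟫) ⟫
    replace a =
      nodes-bounded a >>= λ (δ , oδ , nodes) → initial oδ >>= λ (i , si , below) →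
      ⟨rep⟩ leastᶠ (a ◂ σ)
        (λ β oβ κ oκ κ′ oκ′ p q →
          let (p , min) = proj₁ least↔ p ; (q , min′) = proj₁ least↔ q in
          ≺-tri oκ oκ′ >>= λ where
            (inj₁ r)        → explode (min′ κ r p)
            (inj₂ (inj₁ e)) → e
            (inj₂ (inj₂ r)) → explode (min κ′ r q))
        i si >>= λ (k , _ , images) → bounded k >>= λ (κ* , oκ* , k<κ*) →
      collect (∃′ εᶠ zero (↑² zero) ∧ rename (lift 2 suc) φ) (a ◂ σ)
        (λ {y} {y′} e m → from (to m >>= λ (x , p , q) → return (x , p , invariant ≈-refl e q)))
        oκ*
        (λ y m → to m >>= λ (x , m , p) → m >>= λ (β , r , d) → bounded y >>= λ (κ₀ , oκ₀ , y<κ₀) →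
          least boundsᶠ (β ◂ a ◂ σ) oκ₀ (proj₂ bounds↔ (return (x , return (y , d , p , y<κ₀)))) >>= λ (κ , oκ , q , min) →
          let q = proj₁ bounds↔ q
              κ∈k = images β κ (proj₁ (below β (proj₁ r)) (proj₁ (nodes (proj₁ r) (proj₁ r) (proj₂ r)))) oκ
                      (proj₂ least↔ (q , λ κ′ l s → min κ′ l (proj₂ bounds↔ s)))
          in q >>= λ (x′ , m) → m >>= λ (y′ , d′ , p′ , b) →
          return (y′ , (λ c s → ≺-trans (b c s) (k<κ* κ κ∈k)) ,
            functional x y′ y (invariant (den-≈ d′ d) ≈-refl p′) p))
      >>= λ (b , h) → return (b , λ y → to ∘ proj₁ (h y) , proj₂ (h y) ∘ from)
      where
      open Bound a
      agree : ∀ {x y} i → (x ◂ y ◂ a ◂ σ) (lift 2 suc i) ≡ (x ◂ y ◂ σ) i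
      agree zero          = refl
      agree (suc zero)    = refl
      agree (suc (suc i)) = refl
      to : ⟦ ∃′ εᶠ zero (↑² zero) ∧ rename (lift 2 suc) φ ⟧ (y ◂ a ◂ σ) → ⟪ Σ[ x ∈ D ] x ε a × ⟦ φ ⟧ (x ◂ y ◂ σ) ⟫
      to {y} m = m >>= λ (x , m , p) →
        return (x , (m >>= λ (β , r , d) → return (β , r , pack d)) , proj₁ (⟦rename⟧ (agree {x} {y}) φ) p)
      from : ⟪ Σ[ x ∈ D ] x ε a × ⟦ φ ⟧ (x ◂ y ◂ σ) ⟫ → ⟦ ∃′ εᶠ zero (↑² zero) ∧ rename (lift 2 suc) φ ⟧ (y ◂ a ◂ σ)
      from {y} m = m >>= λ (x , m , p) →
        return (x , (m >>= λ (β , r , d) → return (β , r , unpack d)) , proj₂ (⟦rename⟧ (agree {x} {y}) φ) p)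

  -- Translation, and validity of the axioms of `ZFC`

  open Structure sets using (_ᴬ)

  universe : Interpretation L-∈ R
  universe = record
    { D    = D
    ; relI = λ { ∈ˢ (z ∷ x ∷ []) → z ε x }
    ; eqI  = _≈_
    ; funI = λ ()
    }

  private module V = Interpretation universe

  -- Both sides differ only by the trivially true guard `Uᴬ` and by the packing of `Ext`.
  translate : (ψ : Formula L-∈ n) {σ : Fin n → D} → ⟦ ψ ᴬ ⟧ σ ↔ V.⟦ ψ ⟧ σ
  translate (rel ∈ˢ (var x ∷ var y ∷ [])) = ε-pack , ε-unpack
  translate (rel ∈ˢ (var x ∷ fun () _ ∷ []))
  translate (rel ∈ˢ (fun () _ ∷ _))
  translate (var x ≐ var y)  = pack , unpack
  translate (var x ≐ fun () _)
  translate (fun () _ ≐ _)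
  translate ⊥′      = id , id
  translate (φ ⇒ ψ) = (λ f → proj₁ (translate ψ) ∘ f ∘ proj₂ (translate φ)) ,
                      (λ f → proj₂ (translate ψ) ∘ f ∘ proj₁ (translate φ))
  translate (φ ∧ ψ) = (λ (p , q) → proj₁ (translate φ) p , proj₁ (translate ψ) q) ,
                      (λ (p , q) → proj₂ (translate φ) p , proj₂ (translate ψ) q)
  translate (φ ∨ ψ) =
    (λ m → m >>= λ where
      (inj₁ p) → return (inj₁ (proj₁ (translate φ) p))
      (inj₂ p) → return (inj₂ (proj₁ (translate ψ) p))) ,
    (λ m → m >>= λ where
      (inj₁ p) → return (inj₁ (proj₂ (translate φ) p))
      (inj₂ p) → return (inj₂ (proj₂ (translate ψ) p)))
  translate (∀′ φ)  = (λ f d → proj₁ (translate φ) (f d id)) , (λ f d _ → proj₂ (translate φ) (f d))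
  translate (∃′ φ)  = (λ m → m >>= λ (d , _ , p) → return (d , proj₁ (translate φ) p)) ,
                      (λ m → m >>= λ (d , p) → return (d , id , proj₂ (translate φ) p))

  ◂-≈ : {σ τ : Fin n → D} → (∀ i → σ i ≈ τ i) → ∀ d i → (d ◂ σ) i ≈ (d ◂ τ) i
  ◂-≈ e d zero    = ≈-refl
  ◂-≈ e d (suc i) = e i

  -- This provides the invariance under `≈` that `separate` and `replace` require.
  V-cong : (ψ : Formula L-∈ n) {σ τ : Fin n → D} → (∀ i → σ i ≈ τ i) → V.⟦ ψ ⟧ σ → V.⟦ ψ ⟧ τ
  V-cong (rel ∈ˢ (var x ∷ var y ∷ [])) e p = ε-respˡ (e x) (ε-respʳ (e y) p)
  V-cong (rel ∈ˢ (var x ∷ fun () _ ∷ []))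
  V-cong (rel ∈ˢ (fun () _ ∷ _))
  V-cong (var x ≐ var y)  e p = ext-trans (ext-sym (e x)) (ext-trans p (e y))
  V-cong (var x ≐ fun () _)
  V-cong (fun () _ ≐ _)
  V-cong ⊥′      e p = p
  V-cong (φ ⇒ ψ) e p = V-cong ψ e ∘ p ∘ V-cong φ (ext-sym ∘ e)
  V-cong (φ ∧ ψ) e (p , q) = V-cong φ e p , V-cong ψ e q
  V-cong (φ ∨ ψ) e m = m >>= λ where
    (inj₁ p) → return (inj₁ (V-cong φ e p))
    (inj₂ p) → return (inj₂ (V-cong ψ e p))
  V-cong (∀′ φ)  e p d = V-cong φ (◂-≈ e d) (p d)
  V-cong (∃′ φ)  e m = m >>= λ (d , p) → return (d , V-cong φ (◂-≈ e d) p)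

  -- The single axioms unfold by computation to the lemmas above; only the schemes need
  -- substitutions to be evaluated.
  V⊨ZFC : ∀ {ψ} → ZFC ψ → ∀ σ → V.⟦ ψ ⟧ σ
  V⊨ZFC extensionality σ x y = extensional
  V⊨ZFC foundation σ x = foundational
  V⊨ZFC pairing σ = pair-exists
  V⊨ZFC union σ = union-exists
  V⊨ZFC power σ = power-exists
  V⊨ZFC infinity σ = infinity-exists
  V⊨ZFC choice σ = choice-exists
  V⊨ZFC (separation {n} φ) = V.⟦∀*⟧← n _ λ σ x →
    separate (φ ᴬ) σ (λ {z} {z′} e p → proj₂ (translate φ) (V-cong φ (≈-◂ {σ} e) (proj₁ (translate φ) p))) x
    >>= λ (y , h) → return (y , λ z →
      (λ m → proj₁ (proj₁ (h z) m) , proj₂ (conv σ x y z) (proj₁ (translate φ) (proj₂ (proj₁ (h z) m)))) ,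
      (λ (m , p) → proj₂ (h z) (m , proj₂ (translate φ) (proj₁ (conv σ x y z) p))))
    where
    ≈-◂ : {σ : Fin n → D} → ∀ {z z′} → z ≈ z′ → ∀ i → (z ◂ σ) i ≈ (z′ ◂ σ) i
    ≈-◂ e zero    = e
    ≈-◂ e (suc i) = ≈-refl
    conv : ∀ σ x y z → V.⟦ subst (v0 ◂ params 3) φ ⟧ (z ◂ y ◂ x ◂ σ) ↔ V.⟦ φ ⟧ (z ◂ σ)
    conv σ x y z = V.⟦subst⟧ (λ { zero → refl ; (suc _) → refl }) φ
  V⊨ZFC (replacement {n} φ) = V.⟦∀*⟧← n _ λ σ functional a →
    replace (φ ᴬ) σ
      (λ e e′ p → proj₂ (translate φ) (V-cong φ (≈-◂ {σ} e e′) (proj₁ (translate φ) p)))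
      (λ x y y′ p q → functional x y y′
        (proj₂ (V.⟦subst⟧ agree₁ φ) (proj₁ (translate φ) p) ,
         proj₂ (V.⟦subst⟧ agree₂ φ) (proj₁ (translate φ) q)))
      a
    >>= λ (b , h) → return (b , λ y →
      (λ m → proj₁ (h y) m >>= λ (x , m , p) →
        return (x , m , proj₂ (V.⟦subst⟧ agree₃ φ) (proj₁ (translate φ) p))) ,
      (λ m → m >>= λ (x , m , p) → proj₂ (h y)
        (return (x , m , proj₂ (translate φ) (proj₁ (V.⟦subst⟧ agree₃ φ) p)))))
    where
    ≈-◂ : {σ : Fin n → D} → ∀ {x x′ y y′} → x ≈ x′ → y ≈ y′ → ∀ i → (x ◂ y ◂ σ) i ≈ (x′ ◂ y′ ◂ σ) i
    ≈-◂ e f zero          = e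
    ≈-◂ e f (suc zero)    = f
    ≈-◂ e f (suc (suc i)) = ≈-refl
    agree₁ : ∀ {σ : Fin n → D} {x y y′} i → V.eval ((v2 ◂ v1 ◂ params 3) i) (y′ ◂ y ◂ x ◂ σ) ≡ (x ◂ y ◂ σ) i
    agree₁ zero          = refl
    agree₁ (suc zero)    = refl
    agree₁ (suc (suc i)) = refl
    agree₂ : ∀ {σ : Fin n → D} {x y y′} i → V.eval ((v2 ◂ v0 ◂ params 3) i) (y′ ◂ y ◂ x ◂ σ) ≡ (x ◂ y′ ◂ σ) i
    agree₂ zero          = refl
    agree₂ (suc zero)    = refl
    agree₂ (suc (suc i)) = refl
    agree₃ : ∀ {σ : Fin n → D} {x y a b} i → V.eval ((v0 ◂ v1 ◂ params 4) i) (x ◂ y ◂ b ◂ a ◂ σ) ≡ (x ◂ y ◂ σ) i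
    agree₃ zero          = refl
    agree₃ (suc zero)    = refl
    agree₃ (suc (suc i)) = refl

  sets-nonempty : (σ : Fin 0 → D) → ⟦ ∃′ (⊥′ ⇒ ⊥′) ⟧ σ
  sets-nonempty σ = sound inf ∅ >>= λ (ω , _) → return (ω , id)

prove : ∀ {φ} → (∀ {R} (M : Model SO R) → ∀ σ → Model.⟦_⟧ M φ σ) → SO ⊢ φ
prove = completeness SO-countable

sets-definable : IsDefinable SO sets
sets-definable = record
  { nonempty   = prove λ M → sets-nonempty M
  ; fun-total  = λ ()
  ; fun-unique = λ ()
  ; ≈-refl     = prove λ M σ x _ → unpack M (≈-refl M)
  ; ≈-sym      = prove λ M σ x _ y _ p → unpack M (ext-sym M (pack M p))
  ; ≈-trans    = prove λ M σ x _ y _ z _ (p , q) → unpack M (ext-trans M (pack M p) (pack M q))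
  ; rel-cong   = λ { ∈ˢ → prove λ M σ x _ y _ x′ _ y′ _ e f p →
      ε-unpack M (ε-respˡ M (pack M e) (ε-respʳ M (pack M f) (ε-pack M p))) }
  ; fun-cong   = λ ()
  }
  where open Universe

theorem4 : SO Interprets ZFC
theorem4 = sets , sets-definable , λ {ψ} a → prove λ M σ → proj₂ (Universe.translate M ψ) (Universe.V⊨ZFC M a σ)
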